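{- There is an algorithm that, given a path graph $P$ with vertices $v_1,\dots,v_n$ embedded in a metric space $(V,|\cdot|)$, $V=\{v_1,\dots,v_n\}$, with $O(1)$-time access to every distance $|v_iv_j|$, and given any real value $\lambda$, determines in $O(n)$ time whether $\lambda$ is feasible, i.e. whether there exists a pair $(i,j)$ with $1\le i\le j\le n$ and $D(i,j)\le\lambda$; further, if $\lambda$ is feasible, a feasible edge, i.e. an edge $e(v_i,v_j)$ with $1\le i\le j\le n$ and $D(i,j)\le\lambda$, can be found in $O(n)$ time.
   Context: $P$ is a path graph with vertices $v_1,\dots,v_n$ and an edge between consecutive vertices $v_{k},v_{k+1}$ for $1\le k\le n-1$. The vertex set $V$ carries a distance $|\cdot|$ satisfying $|v_iv_k|+|v_kv_j|\ge|v_iv_j|$, $|v_iv_j|=|v_jv_i|\ge 0$, and $|v_iv_j|=0$ if $i=j$. The edge between $v_k$ and $v_{k+1}$ has length $|v_kv_{k+1}|$. Any distance $|v_iv_j|$ can be obtained in $O(1)$ time; arithmetic operations and comparisons on real numbers take $O(1)$ time (unit-cost RAM model). For a graph $G$ with non-negative edge lengths, $d_G(u,v)$ is the length of a shortest path from $u$ to $v$, and the diameter of $G$ is $\max_{u,v}d_G(u,v)$ over vertices $u,v$ of $G$. For $1\le i\le j\le n$, $G(i,j)$ is the graph obtained from $P$ by adding the edge $e(v_i,v_j)$ of length $|v_iv_j|$ (if $i=j$, $G(i,j)$ is $P$), and $D(i,j)$ is the diameter of $G(i,j)$. -}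

module Defs where

open import Algebra.Bundles using (CommutativeRing)
open import Algebra.Definitions using (Invertible)
open import Data.Bool.Base using (Bool; true; false; not; _∧_; if_then_else_)
open import Data.Fin.Base using (Fin; toℕ; fromℕ<)
import Data.Fin.Base as Fin
open import Data.Nat.Base using (ℕ; suc; _+_; _∸_)
import Data.Nat.Properties as ℕₚ
open import Data.Product.Base using (∃; ∃-syntax; ∃₂; Σ-syntax; _×_; _,_; proj₁)
open import Function.Metric.Definitions using (Symmetric; TriangleInequality)
open import Function.Metric.Structures using (IsPreMetric)
open import Level using (Level; _⊔_; 0ℓ) renaming (suc to lsuc)
open import Relation.Binary.Construct.Closure.ReflexiveTransitive using (Star; ε; _◅_)
open import Relation.Binary.Construct.Closure.Symmetric using (SymClosure; fwd; bwd)
open import Relation.Binary.Core using (Rel)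
open import Relation.Binary.PropositionalEquality.Core using (_≡_; _≢_)
open import Relation.Binary.Structures using (IsDecTotalOrder)
open import Relation.Nullary.Decidable.Core using (yes; no; does)
open import Relation.Nullary.Negation.Core using (¬_)
open import Relation.Unary using (Pred)

record OrderedField c ℓ₁ ℓ₂ : Set (lsuc (c ⊔ ℓ₁ ⊔ ℓ₂)) where
  field
    commutativeRing : CommutativeRing c ℓ₁
  open CommutativeRing commutativeRing public
    using (Carrier; _≈_; 0#; 1#; _-_)
    renaming (_+_ to _+ᵣ_; _*_ to _*ᵣ_)
  infix 4 _≤ᵣ_
  field
    _≤ᵣ_            : Rel Carrier ℓ₂
    isDecTotalOrder : IsDecTotalOrder _≈_ _≤ᵣ_
    +-monoˡ-≤       : ∀ {x y} z → x ≤ᵣ y → x +ᵣ z ≤ᵣ y +ᵣ z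
    *-nonNegative   : ∀ {x y} → 0# ≤ᵣ x → 0# ≤ᵣ y → 0# ≤ᵣ x *ᵣ y
    1≉0             : ¬ 1# ≈ 0#
    ≉0⇒invertible   : ∀ x → ¬ x ≈ 0# → Invertible _≈_ 1# _*ᵣ_ x
  open IsDecTotalOrder isDecTotalOrder public using (_≟_; _≤?_)

-- ℝ is characterised as the complete ordered field.  Decidability of the
-- order (part of OrderedField) is what the machine model needs in order
-- to branch on comparisons of reals.
record RealNumbers c ℓ₁ ℓ₂ : Set (lsuc (c ⊔ ℓ₁ ⊔ ℓ₂)) where
  field
    orderedField : OrderedField c ℓ₁ ℓ₂
  open OrderedField orderedField public

  UpperBound : Pred Carrier (c ⊔ ℓ₁ ⊔ ℓ₂) → Pred Carrier (c ⊔ ℓ₁ ⊔ ℓ₂)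
  UpperBound S u = ∀ {x} → S x → x ≤ᵣ u

  field
    complete : (S : Pred Carrier (c ⊔ ℓ₁ ⊔ ℓ₂)) → ∃ S → ∃ (UpperBound S) →
               ∃[ s ] (UpperBound S s × (∀ {u} → UpperBound S u → s ≤ᵣ u))

-- Programs of the unit-cost RAM.  The memory consists of arrays of
-- natural numbers and arrays of reals; a program names finitely many
-- arrays by literals and addresses their cells by computed indices.
-- There is no rounding of reals to naturals and no multiplication of
-- naturals.

infix  8 nat⟨_⟩[_] real⟨_⟩[_]
infixl 7 _⊗_ _⊘_
infixl 6 _⊞_ _⊟_ _⊕_ _⊖_
infix  5 _≤ℕ_ _≤ℝ_
infix  4 nat⟨_⟩[_]≔_ real⟨_⟩[_]≔_
infixr 3 _⨾_

data NatExp : Set where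
  lit      : ℕ → NatExp
  nat⟨_⟩[_] : ℕ → NatExp → NatExp
  _⊞_ _⊟_  : NatExp → NatExp → NatExp

data RealExp : Set where
  zero one        : RealExp
  real⟨_⟩[_]       : ℕ → NatExp → RealExp
  distance        : NatExp → NatExp → RealExp
  _⊕_ _⊖_ _⊗_ _⊘_ : RealExp → RealExp → RealExp

data Test : Set where
  _≤ℕ_ : NatExp → NatExp → Test
  _≤ℝ_ : RealExp → RealExp → Test
  neg  : Test → Test
  both : Test → Test → Test

data Program : Set where
  skip          : Program
  nat⟨_⟩[_]≔_    : ℕ → NatExp → NatExp → Program
  real⟨_⟩[_]≔_   : ℕ → NatExp → RealExp → Program
  _⨾_           : Program → Program → Program
  cond          : Test → Program → Program → Program
  while         : Test → Program → Program

-- Evaluation costs: one unit for each literal, memory access, distance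
-- query, arithmetic operation, comparison and connective.

natCost : NatExp → ℕ
natCost (lit _)         = 1
natCost nat⟨ _ ⟩[ k ]    = suc (natCost k)
natCost (e ⊞ f)         = suc (natCost e + natCost f)
natCost (e ⊟ f)         = suc (natCost e + natCost f)

realCost : RealExp → ℕ
realCost zero           = 1
realCost one            = 1
realCost real⟨ _ ⟩[ k ]  = suc (natCost k)
realCost (distance k l) = suc (natCost k + natCost l)
realCost (e ⊕ f)        = suc (realCost e + realCost f)
realCost (e ⊖ f)        = suc (realCost e + realCost f)
realCost (e ⊗ f)        = suc (realCost e + realCost f)
realCost (e ⊘ f)        = suc (realCost e + realCost f)

testCost : Test → ℕ
testCost (e ≤ℕ f)       = suc (natCost e + natCost f)
testCost (e ≤ℝ f)       = suc (realCost e + realCost f)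
testCost (neg b)        = suc (testCost b)
testCost (both b b′)    = suc (testCost b + testCost b′)

_[_,_]≔_ : ∀ {ℓ} {A : Set ℓ} → (ℕ → ℕ → A) → ℕ → ℕ → A → (ℕ → ℕ → A)
(m [ a , k ]≔ x) b l = if does (a ℕₚ.≟ b) ∧ does (k ℕₚ.≟ l) then x else m b l

module OverField {c ℓ₁ ℓ₂} (F : OrderedField c ℓ₁ ℓ₂) where
  open OrderedField F

  record Store : Set c where
    constructor store
    field
      nats  : ℕ → ℕ → ℕ
      reals : ℕ → ℕ → Carrier
  open Store public

  -- Division by zero yields zero.
  divide : Carrier → Carrier → Carrier
  divide x y with y ≟ 0#
  ... | yes _   = 0#
  ... | no y≉0 = x *ᵣ proj₁ (≉0⇒invertible y y≉0)

  module Execution (oracle : ℕ → ℕ → Carrier) where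

    evalNat : NatExp → Store → ℕ
    evalNat (lit k)         σ = k
    evalNat nat⟨ a ⟩[ k ]    σ = nats σ a (evalNat k σ)
    evalNat (e ⊞ f)         σ = evalNat e σ + evalNat f σ
    evalNat (e ⊟ f)         σ = evalNat e σ ∸ evalNat f σ

    evalReal : RealExp → Store → Carrier
    evalReal zero           σ = 0#
    evalReal one            σ = 1#
    evalReal real⟨ a ⟩[ k ]  σ = reals σ a (evalNat k σ)
    evalReal (distance k l) σ = oracle (evalNat k σ) (evalNat l σ)
    evalReal (e ⊕ f)        σ = evalReal e σ +ᵣ evalReal f σ
    evalReal (e ⊖ f)        σ = evalReal e σ - evalReal f σ
    evalReal (e ⊗ f)        σ = evalReal e σ *ᵣ evalReal f σ
    evalReal (e ⊘ f)        σ = divide (evalReal e σ) (evalReal f σ)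

    evalTest : Test → Store → Bool
    evalTest (e ≤ℕ f)       σ = does (evalNat e σ ℕₚ.≤? evalNat f σ)
    evalTest (e ≤ℝ f)       σ = does (evalReal e σ ≤? evalReal f σ)
    evalTest (neg b)        σ = not (evalTest b σ)
    evalTest (both b b′)    σ = evalTest b σ ∧ evalTest b′ σ

    -- ⟨ p , σ ⟩⇓[ t ] τ : started in σ, p halts in τ after t time units.
    infix 2 ⟨_,_⟩⇓[_]_
    data ⟨_,_⟩⇓[_]_ : Program → Store → ℕ → Store → Set c where
      ⇓skip  : ∀ {σ} → ⟨ skip , σ ⟩⇓[ 1 ] σ
      ⇓nat   : ∀ {σ a k e} →
               ⟨ nat⟨ a ⟩[ k ]≔ e , σ ⟩⇓[ suc (natCost k + natCost e) ]
               store (nats σ [ a , evalNat k σ ]≔ evalNat e σ) (reals σ)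
      ⇓real  : ∀ {σ a k e} →
               ⟨ real⟨ a ⟩[ k ]≔ e , σ ⟩⇓[ suc (natCost k + realCost e) ]
               store (nats σ) (reals σ [ a , evalNat k σ ]≔ evalReal e σ)
      ⇓seq   : ∀ {p q σ τ υ s t} →
               ⟨ p , σ ⟩⇓[ s ] τ → ⟨ q , τ ⟩⇓[ t ] υ →
               ⟨ p ⨾ q , σ ⟩⇓[ s + t ] υ
      ⇓then  : ∀ {b p q σ τ t} → evalTest b σ ≡ true →
               ⟨ p , σ ⟩⇓[ t ] τ →
               ⟨ cond b p q , σ ⟩⇓[ suc (testCost b + t) ] τ
      ⇓else  : ∀ {b p q σ τ t} → evalTest b σ ≡ false →
               ⟨ q , σ ⟩⇓[ t ] τ →
               ⟨ cond b p q , σ ⟩⇓[ suc (testCost b + t) ] τ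
      ⇓done  : ∀ {b p σ} → evalTest b σ ≡ false →
               ⟨ while b p , σ ⟩⇓[ suc (testCost b) ] σ
      ⇓loop  : ∀ {b p σ τ υ s t} → evalTest b σ ≡ true →
               ⟨ p , σ ⟩⇓[ s ] τ → ⟨ while b p , τ ⟩⇓[ t ] υ →
               ⟨ while b p , σ ⟩⇓[ suc (testCost b + (s + t)) ] υ

  -- Edges are undirected: each is listed in one orientation here and may
  -- be traversed in both by walks.
  record Graph : Set (lsuc 0ℓ ⊔ c) where
    field
      Vertex : Set
      Edge   : Rel Vertex 0ℓ
      length : ∀ {u v} → Edge u v → Carrier

  IsMinimum IsMaximum : ∀ {ℓ} → Pred Carrier ℓ → Pred Carrier (c ⊔ ℓ₂ ⊔ ℓ)
  IsMinimum S x = S x × (∀ {y} → S y → x ≤ᵣ y)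
  IsMaximum S x = S x × (∀ {y} → S y → y ≤ᵣ x)

  module _ (G : Graph) where
    open Graph G

    -- With non-negative lengths, shortest walks and shortest paths have
    -- the same length.
    Walk : Rel Vertex 0ℓ
    Walk = Star (SymClosure Edge)

    walkLength : ∀ {u v} → Walk u v → Carrier
    walkLength ε           = 0#
    walkLength (fwd e ◅ w) = length e +ᵣ walkLength w
    walkLength (bwd e ◅ w) = length e +ᵣ walkLength w

    IsDistance : Vertex → Vertex → Pred Carrier (c ⊔ ℓ₁ ⊔ ℓ₂)
    IsDistance u v = IsMinimum (λ x → ∃[ w ] walkLength {u} {v} w ≈ x)

    IsDiameter : Pred Carrier (c ⊔ ℓ₁ ⊔ ℓ₂)
    IsDiameter D =
      Σ[ δ ∈ (Vertex → Vertex → Carrier) ]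
        (∀ u v → IsDistance u v (δ u v)) ×
        IsMaximum (λ x → Σ[ u ∈ Vertex ] Σ[ v ∈ Vertex ] δ u v ≈ x) D

  -- The vertex v_k is represented by k - 1 : Fin n.  Distinct vertices may
  -- have distance zero.
  record MetricPath (n : ℕ) : Set (c ⊔ ℓ₁ ⊔ ℓ₂) where
    field
      dist        : Fin n → Fin n → Carrier
      isPreMetric : IsPreMetric _≡_ _≈_ _≤ᵣ_ 0# dist
      symmetric   : Symmetric _≈_ dist
      triangle    : TriangleInequality _≤ᵣ_ _+ᵣ_ dist

  data AugmentedEdge {n} (i j : Fin n) : Rel (Fin n) 0ℓ where
    path  : ∀ {k l} → toℕ l ≡ suc (toℕ k) → AugmentedEdge i j k l
    added : i ≢ j → AugmentedEdge i j i j

  module _ {n} (P : MetricPath n) where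
    open MetricPath P

    augment : Fin n → Fin n → Graph
    augment i j = record
      { Vertex = Fin n
      ; Edge   = AugmentedEdge i j
      ; length = λ {u} {v} _ → dist u v
      }

    FeasibleEdge : Carrier → Fin n → Fin n → Set (c ⊔ ℓ₁ ⊔ ℓ₂)
    FeasibleEdge bound i j =
      i Fin.≤ j × ∃[ D ] (IsDiameter (augment i j) D × D ≤ᵣ bound)

    Feasible : Pred Carrier (c ⊔ ℓ₁ ⊔ ℓ₂)
    Feasible bound = ∃₂ (FeasibleEdge bound)

    -- Queries outside the vertex set are answered by zero.
    distanceOracle : ℕ → ℕ → Carrier
    distanceOracle k l with k ℕₚ.<? n | l ℕₚ.<? n
    ... | yes k<n | yes l<n = dist (fromℕ< k<n) (fromℕ< l<n)
    ... | _       | _       = 0#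

    open Execution distanceOracle public
      using () renaming (⟨_,_⟩⇓[_]_ to Runs)

  -- n is in cell 0 of natural array 0 and the bound is in cell 0 of real
  -- array 0; all other cells are zero.
  input : ℕ → Carrier → Store
  input n bound = store ((λ _ _ → 0)  [ 0 , 0 ]≔ n)
                        ((λ _ _ → 0#) [ 0 , 0 ]≔ bound)

  output : Store → ℕ → ℕ
  output σ = nats σ 0

{-# OPTIONS --safe #-}

-- Let x_k be the position of v_k along the path, and call a pair k, l far if
-- x_l - x_k > λ.  For i ≤ j the shortcut (i , j) is feasible exactly when
-- |x_k - x_i| + |v_i v_j| + |x_l - x_j| ≤ λ for every far pair, i.e. when the
-- point (x_i , x_j) lies within L₁-distance λ - |v_i v_j| of every (x_k , x_l).
-- An L₁-ball is cut out by four linear inequalities, so only four far pairs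
-- matter, those extremal for x_k + x_l and x_l - x_k; a two-pointer scan
-- finds them.  By the triangle inequality each of the four constraints on
-- (i , j) is monotone in i and in j, two of them upwards and two downwards in
-- j.  As i increases, the least j meeting the first constraint of the former
-- kind decreases and the least j meeting the second increases, so both are
-- tracked in linear time, and only the larger of the two has to be tested.

module Submission where

open import Defs
open import Algebra.Bundles using (CommutativeRing)
open import Data.Bool.Base using (true; false; not; _∧_; if_then_else_)
open import Data.Empty using (⊥)
open import Data.Fin.Base using (Fin; toℕ; fromℕ<)
import Data.Fin.Base as Fin
import Data.Fin.Properties as Finₚ
import Data.List.Extrema as Extrema
open import Data.List.Base using (List; allFin; cartesianProduct)
open import Data.List.Membership.Propositional.Properties using (∈-allFin; ∈-cartesianProduct⁺)
import Data.List.Relation.Unary.All as All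
open import Data.Nat.Base
  using (ℕ; zero; suc; NonZero; _+_; _*_; _∸_; _⊔_; _≤_; _<_; z≤n; s≤s)
import Data.Nat.Properties as ℕₚ
open import Data.Nat.Solver using (module +-*-Solver)
open import Data.Product.Base using (∃; ∃-syntax; ∃₂; Σ-syntax; _×_; _,_; proj₁; proj₂)
open import Data.Sum.Base using (_⊎_; inj₁; inj₂; swap)
open import Data.Unit.Base using (⊤)
open import Data.Vec.Base using (Vec; _∷_; [])
import Data.Vec.Base as Vec
open import Data.Vec.N-ary using (N-ary; _$ⁿ_)
open import Function.Metric.Structures using (IsPreMetric)
import Level
open import Relation.Binary.Bundles using (TotalOrder)
open import Relation.Binary.Construct.Closure.ReflexiveTransitive using (ε; _◅_; _◅◅_)
open import Relation.Binary.Construct.Closure.Symmetric using (fwd; bwd)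
open import Relation.Binary.PropositionalEquality
  using (_≡_; _≢_; refl; sym; trans; cong; cong₂; subst)
open import Relation.Binary.Structures using (IsDecTotalOrder)
open import Relation.Nullary.Decidable
  using (dec-true; dec-false; decidable-stable; map′; ¬?; _×-dec_)
open import Relation.Nullary.Decidable.Core using (Dec; yes; no; does)
open import Relation.Nullary.Negation.Core using (¬_; contradiction)

-- Linear inequalities, absolute differences and L₁-balls over an ordered field.

module LinearArithmetic {c ℓ₁ ℓ₂} (F : OrderedField c ℓ₁ ℓ₂) where
  open OrderedField F
  open CommutativeRing commutativeRing public
    using (+-identityˡ; +-identityʳ; +-assoc; +-comm; +-cong; -_; -‿inverseʳ; +-commutativeMonoid)
    renaming (refl to ≈-refl; sym to ≈-sym; trans to ≈-trans)
  open IsDecTotalOrder isDecTotalOrder public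
    using (isTotalOrder)
    renaming (refl to ≤-refl; reflexive to ≤-reflexive; trans to ≤-trans; total to ≤-total)
  open import Algebra.Solver.CommutativeMonoid.Normal +-commutativeMonoid public
    using (Expr; Env; var; id; ⟦_⟧; ⟦_⟧⇓; normalise; correct)
    renaming (_⊕_ to infixr 5 _∙_)

  totalOrder : TotalOrder c ℓ₁ ℓ₂
  totalOrder = record { isTotalOrder = isTotalOrder }

  ≰⇒≥ : ∀ {a b} → ¬ a ≤ᵣ b → b ≤ᵣ a
  ≰⇒≥ {a} {b} a≰b with ≤-total a b
  ... | inj₁ a≤b = contradiction a≤b a≰b
  ... | inj₂ b≤a = b≤a

  infixr 6 _+≤_
  _+≤_ : ∀ {a b a′ b′} → a ≤ᵣ b → a′ ≤ᵣ b′ → a +ᵣ a′ ≤ᵣ b +ᵣ b′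
  _+≤_ {a} {b} {a′} {b′} a≤b a′≤b′ = ≤-trans (+-monoˡ-≤ a′ a≤b)
    (≤-trans (≤-reflexive (+-comm b a′))
    (≤-trans (+-monoˡ-≤ b a′≤b′) (≤-reflexive (+-comm b′ b))))

  +-cancelʳ-≤ : ∀ {a b} z → a +ᵣ z ≤ᵣ b +ᵣ z → a ≤ᵣ b
  +-cancelʳ-≤ {a} {b} z a+z≤b+z = ≤-trans (≤-reflexive (≈-sym (drop a)))
    (≤-trans (+-monoˡ-≤ (- z) a+z≤b+z) (≤-reflexive (drop b)))
    where
    drop : ∀ y → (y +ᵣ z) +ᵣ (- z) ≈ y
    drop y = ≈-trans (+-assoc y z (- z))
      (≈-trans (+-cong ≈-refl (-‿inverseʳ z)) (+-identityʳ y))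

  infix 4 _≼_
  infix 3 _⟹_

  data Inequality m : Set where
    _≼_ : Expr m → Expr m → Inequality m

  data Consequence m : Set where
    _⟹_ : Inequality m → Inequality m → Consequence m

  variables : ∀ m → Vec (Expr m) m
  variables m = Vec.map var (Vec.allFin m)

  Holds : ∀ {m} → Env m → Inequality m → Set ℓ₂
  Holds ρ (s ≼ t) = ⟦ s ⟧ ρ ≤ᵣ ⟦ t ⟧ ρ

  -- s′ - t′ = s - t, without subtraction.
  Balanced : ∀ {m} → Consequence m → Set
  Balanced (s ≼ t ⟹ s′ ≼ t′) = normalise (s′ ∙ t) ≡ normalise (t′ ∙ s)

  premise conclusion : ∀ {m} → Consequence m → Inequality m
  premise    (h ⟹ _) = h
  conclusion (_ ⟹ g) = g

  -- Balance gives s′ + t = t′ + s ≤ t′ + t, and t cancels.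
  balanced⇒holds : ∀ {m} (ρ : Env m) (C : Consequence m) → Balanced C →
                   Holds ρ (premise C) → Holds ρ (conclusion C)
  balanced⇒holds ρ (s ≼ t ⟹ s′ ≼ t′) eq s≤t = +-cancelʳ-≤ (⟦ t ⟧ ρ)
    (≤-trans (≤-reflexive equal) (≤-refl +≤ s≤t))
    where
    equal : ⟦ s′ ∙ t ⟧ ρ ≈ ⟦ t′ ∙ s ⟧ ρ
    equal = ≈-trans (≈-sym (correct (s′ ∙ t) ρ))
      (subst (λ e → ⟦ e ⟧⇓ ρ ≈ ⟦ t′ ∙ s ⟧ ρ) (sym eq) (correct (t′ ∙ s) ρ))

  -- Linear steps by reflection: the hypotheses are added up with `+≤` to form one premise, and
  -- `refl` checks the balance by comparing monoid normal forms.
  linear : ∀ {m} (ρ : Env m) (f : N-ary m (Expr m) (Consequence m)) →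
           Balanced (f $ⁿ variables m) →
           Holds ρ (premise (f $ⁿ variables m)) → Holds ρ (conclusion (f $ⁿ variables m))
  linear {m} ρ f = balanced⇒holds ρ (f $ⁿ variables m)

  x≤x+y : ∀ {x y} → 0# ≤ᵣ y → x ≤ᵣ x +ᵣ y
  x≤x+y {x} {y} 0≤y = linear (x ∷ y ∷ []) (λ x y → id ≼ y ⟹ x ≼ x ∙ y) refl 0≤y

  -- This is |a - b| ≤ g without subtraction or absolute value.
  Near : Carrier → Carrier → Carrier → Set ℓ₂
  Near a b g = a ≤ᵣ b +ᵣ g × b ≤ᵣ a +ᵣ g

  near-sym : ∀ {a b g} → Near a b g → Near b a g
  near-sym (a≤ , b≤) = b≤ , a≤

  near-trans : ∀ {a b c g h} → Near a b g → Near b c h → Near a c (g +ᵣ h)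
  near-trans {a} {b} {c} {g} {h} (a≤b , b≤a) (b≤c , c≤b) =
    linear (a ∷ b ∷ c ∷ g ∷ h ∷ [])
      (λ a b c g h → a ∙ b ≼ (b ∙ g) ∙ (c ∙ h) ⟹ a ≼ c ∙ (g ∙ h)) refl (a≤b +≤ b≤c) ,
    linear (a ∷ b ∷ c ∷ g ∷ h ∷ [])
      (λ a b c g h → b ∙ c ≼ (a ∙ g) ∙ (b ∙ h) ⟹ c ≼ a ∙ (g ∙ h)) refl (b≤a +≤ c≤b)

  near-mono : ∀ {a b g h} → g ≤ᵣ h → Near a b g → Near a b h
  near-mono g≤h (a≤b , b≤a) =
    ≤-trans a≤b (≤-refl +≤ g≤h) , ≤-trans b≤a (≤-refl +≤ g≤h)

  near-refl : ∀ {a} → Near a a 0#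
  near-refl {a} = ≤-reflexive (≈-sym (+-identityʳ a)) , ≤-reflexive (≈-sym (+-identityʳ a))

  -- The opposite bound, g ≤ |a - b|.
  Tight : Carrier → Carrier → Carrier → Set ℓ₂
  Tight a b g = a +ᵣ g ≤ᵣ b ⊎ b +ᵣ g ≤ᵣ a

  tight≤near : ∀ {a b g h} → Tight a b g → Near a b h → g ≤ᵣ h
  tight≤near {a} {b} {g} {h} (inj₁ a+g≤b) (_ , b≤a+h) = linear (a ∷ b ∷ g ∷ h ∷ [])
    (λ a b g h → (a ∙ g) ∙ b ≼ b ∙ (a ∙ h) ⟹ g ≼ h) refl (a+g≤b +≤ b≤a+h)
  tight≤near {a} {b} {g} {h} (inj₂ b+g≤a) (a≤b+h , _) = linear (a ∷ b ∷ g ∷ h ∷ [])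
    (λ a b g h → (b ∙ g) ∙ a ≼ a ∙ (b ∙ h) ⟹ g ≼ h) refl (b+g≤a +≤ a≤b+h)

  -- The pair (a , b) lies within L₁-distance bound - d of (p , q).
  record Within (bound d a b p q : Carrier) : Set ℓ₂ where
    constructor within
    field
      below  : (a +ᵣ b) +ᵣ d ≤ᵣ bound +ᵣ (p +ᵣ q)
      above  : (p +ᵣ q) +ᵣ d ≤ᵣ bound +ᵣ (a +ᵣ b)
      wide   : (a +ᵣ q) +ᵣ d ≤ᵣ bound +ᵣ (b +ᵣ p)
      narrow : (b +ᵣ p) +ᵣ d ≤ᵣ bound +ᵣ (a +ᵣ q)

  -- The signs of a - p and b - q select the one inequality of `Within` that is needed.
  within⇒detour≤ : ∀ {bound d a b p q g h} → Within bound d a b p q →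
                   Tight a p g → Tight b q h → g +ᵣ (d +ᵣ h) ≤ᵣ bound
  within⇒detour≤ {bound} {d} {a} {b} {p} {q} {g} {h} (within _ above _ _) (inj₁ ag) (inj₁ bh) =
    linear (bound ∷ d ∷ a ∷ b ∷ p ∷ q ∷ g ∷ h ∷ [])
      (λ m d a b p q g h → ((p ∙ q) ∙ d) ∙ (a ∙ g) ∙ (b ∙ h) ≼ (m ∙ (a ∙ b)) ∙ p ∙ q ⟹
        g ∙ (d ∙ h) ≼ m) refl (above +≤ ag +≤ bh)
  within⇒detour≤ {bound} {d} {a} {b} {p} {q} {g} {h} (within _ _ _ narrow) (inj₁ ag) (inj₂ qh) =
    linear (bound ∷ d ∷ a ∷ b ∷ p ∷ q ∷ g ∷ h ∷ [])
      (λ m d a b p q g h → ((b ∙ p) ∙ d) ∙ (a ∙ g) ∙ (q ∙ h) ≼ (m ∙ (a ∙ q)) ∙ p ∙ b ⟹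
        g ∙ (d ∙ h) ≼ m) refl (narrow +≤ ag +≤ qh)
  within⇒detour≤ {bound} {d} {a} {b} {p} {q} {g} {h} (within _ _ wide _) (inj₂ pg) (inj₁ bh) =
    linear (bound ∷ d ∷ a ∷ b ∷ p ∷ q ∷ g ∷ h ∷ [])
      (λ m d a b p q g h → ((a ∙ q) ∙ d) ∙ (p ∙ g) ∙ (b ∙ h) ≼ (m ∙ (b ∙ p)) ∙ a ∙ q ⟹
        g ∙ (d ∙ h) ≼ m) refl (wide +≤ pg +≤ bh)
  within⇒detour≤ {bound} {d} {a} {b} {p} {q} {g} {h} (within below _ _ _) (inj₂ pg) (inj₂ qh) =
    linear (bound ∷ d ∷ a ∷ b ∷ p ∷ q ∷ g ∷ h ∷ [])
      (λ m d a b p q g h → ((a ∙ b) ∙ d) ∙ (p ∙ g) ∙ (q ∙ h) ≼ (m ∙ (p ∙ q)) ∙ a ∙ b ⟹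
        g ∙ (d ∙ h) ≼ m) refl (below +≤ pg +≤ qh)

  detour≤⇒within : ∀ {bound d a b p q g h} → g +ᵣ (d +ᵣ h) ≤ᵣ bound →
                   Near p a g → Near b q h → Within bound d a b p q
  detour≤⇒within {bound} {d} {a} {b} {p} {q} {g} {h} len (p≤ , a≤) (b≤ , q≤) = within
    (linear ρ (λ m d a b p q g h → (g ∙ (d ∙ h)) ∙ a ∙ b ≼ m ∙ (p ∙ g) ∙ (q ∙ h) ⟹
      (a ∙ b) ∙ d ≼ m ∙ (p ∙ q)) refl (len +≤ a≤ +≤ b≤))
    (linear ρ (λ m d a b p q g h → (g ∙ (d ∙ h)) ∙ p ∙ q ≼ m ∙ (a ∙ g) ∙ (b ∙ h) ⟹
      (p ∙ q) ∙ d ≼ m ∙ (a ∙ b)) refl (len +≤ p≤ +≤ q≤))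
    (linear ρ (λ m d a b p q g h → (g ∙ (d ∙ h)) ∙ a ∙ q ≼ m ∙ (p ∙ g) ∙ (b ∙ h) ⟹
      (a ∙ q) ∙ d ≼ m ∙ (b ∙ p)) refl (len +≤ a≤ +≤ q≤))
    (linear ρ (λ m d a b p q g h → (g ∙ (d ∙ h)) ∙ p ∙ b ≼ m ∙ (a ∙ g) ∙ (q ∙ h) ⟹
      (b ∙ p) ∙ d ≼ m ∙ (a ∙ q)) refl (len +≤ p≤ +≤ b≤))
    where ρ = bound ∷ d ∷ a ∷ b ∷ p ∷ q ∷ g ∷ h ∷ []

  -- Exchanging the ends of a far pair only shrinks the L₁-distance, since
  -- a ≤ b and p ≤ q.
  within-swap : ∀ {bound d a b p q} → a ≤ᵣ b → p ≤ᵣ q →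
                Within bound d b a p q → Within bound d a b p q
  within-swap {bound} {d} {a} {b} {p} {q} a≤b p≤q (within below above wide narrow) = within
    (linear ρ (λ m d a b p q → (b ∙ a) ∙ d ≼ m ∙ (p ∙ q) ⟹ (a ∙ b) ∙ d ≼ m ∙ (p ∙ q))
      refl below)
    (linear ρ (λ m d a b p q → (p ∙ q) ∙ d ≼ m ∙ (b ∙ a) ⟹ (p ∙ q) ∙ d ≼ m ∙ (a ∙ b))
      refl above)
    (linear ρ (λ m d a b p q → ((b ∙ q) ∙ d) ∙ a ∙ a ≼ (m ∙ (a ∙ p)) ∙ b ∙ b ⟹
      (a ∙ q) ∙ d ≼ m ∙ (b ∙ p)) refl (wide +≤ a≤b +≤ a≤b))
    (linear ρ (λ m d a b p q → ((b ∙ q) ∙ d) ∙ p ∙ p ≼ (m ∙ (a ∙ p)) ∙ q ∙ q ⟹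
      (b ∙ p) ∙ d ≼ m ∙ (a ∙ q)) refl (wide +≤ p≤q +≤ p≤q))
    where ρ = bound ∷ d ∷ a ∷ b ∷ p ∷ q ∷ []

-- Walks in the augmented path, shortest walks and the diameter.

module Shortcut {c ℓ₁ ℓ₂} (F : OrderedField c ℓ₁ ℓ₂) {n} (P : OverField.MetricPath F n)
                (x : Fin n → OrderedField.Carrier F)
                (x-step : ∀ {k l} → toℕ l ≡ suc (toℕ k) →
                          OrderedField._≈_ F (x l)
                            (OrderedField._+ᵣ_ F (x k) (OverField.MetricPath.dist P k l)))
                where
  open OrderedField F
  open LinearArithmetic F
  open OverField F
  open MetricPath P
  open IsPreMetric isPreMetric using (nonNegative; ≈⇒0)
  open Extrema totalOrder using (argmax; f[xs]≤f[argmax])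

  maximum : (f : Fin n → Fin n → Carrier) → Fin n →
            ∃₂ λ u v → ∀ u′ v′ → f u′ v′ ≤ᵣ f u v
  maximum f u₀ = proj₁ (argmax g (u₀ , u₀) pairs) , proj₂ (argmax g (u₀ , u₀) pairs) ,
    λ u v → All.lookup (f[xs]≤f[argmax] {f = g} (u₀ , u₀) pairs)
                       (∈-cartesianProduct⁺ (∈-allFin u) (∈-allFin v))
    where
    g : Fin n × Fin n → Carrier
    g (u , v) = f u v
    pairs : List (Fin n × Fin n)
    pairs = cartesianProduct (allFin n) (allFin n)

  module _ {i j : Fin n} where

    private
      G = augment P i j
      len : ∀ {u v} → Walk G u v → Carrier
      len = walkLength G

    walkLength-◅◅ : ∀ {u v w} (p : Walk G u v) (q : Walk G v w) →
                    len (p ◅◅ q) ≈ len p +ᵣ len q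
    walkLength-◅◅ ε           q = ≈-sym (+-identityˡ _)
    walkLength-◅◅ (fwd e ◅ p) q =
      ≈-trans (+-cong ≈-refl (walkLength-◅◅ p q)) (≈-sym (+-assoc _ _ _))
    walkLength-◅◅ (bwd e ◅ p) q =
      ≈-trans (+-cong ≈-refl (walkLength-◅◅ p q)) (≈-sym (+-assoc _ _ _))

    reverse : ∀ {u v} (p : Walk G u v) → Σ[ q ∈ Walk G v u ] len q ≈ len p
    reverse ε = ε , ≈-refl
    reverse (fwd e ◅ p) with reverse p
    ... | q , eq = q ◅◅ (bwd e ◅ ε) ,
      ≈-trans (walkLength-◅◅ q _) (≈-trans (+-comm _ _) (+-cong (+-identityʳ _) eq))
    reverse (bwd e ◅ p) with reverse p
    ... | q , eq = q ◅◅ (fwd e ◅ ε) ,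
      ≈-trans (walkLength-◅◅ q _) (≈-trans (+-comm _ _) (+-cong (+-identityʳ _) eq))

    dist≤walkLength : ∀ {u v} (p : Walk G u v) → dist u v ≤ᵣ len p
    dist≤walkLength ε = ≤-reflexive (≈⇒0 refl)
    dist≤walkLength (fwd e ◅ p) =
      ≤-trans (triangle _ _ _) (≤-refl +≤ dist≤walkLength p)
    dist≤walkLength (bwd e ◅ p) =
      ≤-trans (triangle _ _ _) (≤-reflexive (symmetric _ _) +≤ dist≤walkLength p)

    successor : ∀ {u v : Fin n} → u Fin.< v → ∃[ w ] toℕ w ≡ suc (toℕ u)
    successor {u} {v} u<v = fromℕ< u+1<n , Finₚ.toℕ-fromℕ< u+1<n
      where
      u+1<n : suc (toℕ u) < n
      u+1<n = ℕₚ.≤-<-trans u<v (Finₚ.toℕ<n v)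

    private
      pathWalk′ : ∀ m {u v} → toℕ v ≡ m + toℕ u → Σ[ p ∈ Walk G u v ] x u +ᵣ len p ≤ᵣ x v
      pathWalk′ zero {u} {v} eq with Finₚ.toℕ-injective {i = v} {j = u} eq
      ... | refl = ε , ≤-reflexive (+-identityʳ _)
      pathWalk′ (suc m) {u} {v} eq
        with w , w≡ ← successor {u} {v} (subst (toℕ u <_) (sym eq) (s≤s (ℕₚ.m≤n+m _ m)))
        with p , x+p≤ ← pathWalk′ m {w} {v}
               (trans eq (trans (sym (ℕₚ.+-suc m _)) (cong (m +_) (sym w≡))))
        = fwd (path w≡) ◅ p ,
          ≤-trans (≤-reflexive (≈-trans (≈-sym (+-assoc _ _ _))
                                        (+-cong (≈-sym (x-step w≡)) ≈-refl))) x+p≤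

    pathWalk : ∀ {u v} → u Fin.≤ v → Σ[ p ∈ Walk G u v ] x u +ᵣ len p ≤ᵣ x v
    pathWalk {u} {v} u≤v = pathWalk′ _ (sym (ℕₚ.m∸n+n≡m u≤v))

    tightWalk : ∀ u v → Σ[ p ∈ Walk G u v ] Tight (x u) (x v) (len p)
    tightWalk u v with ℕₚ.≤-total (toℕ u) (toℕ v)
    ... | inj₁ u≤v = let p , x+p≤ = pathWalk u≤v in p , inj₁ x+p≤
    ... | inj₂ v≤u = let p , x+p≤ = pathWalk v≤u ; q , q≈p = reverse p in
      q , inj₂ (≤-trans (≤-refl +≤ ≤-reflexive q≈p) x+p≤)

    shortcutWalk : Σ[ p ∈ Walk G i j ] len p ≤ᵣ dist i j
    shortcutWalk with i Finₚ.≟ j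
    -- No edge is added when the ends coincide; the empty walk stands in for it.
    ... | yes refl = ε , nonNegative
    ... | no i≢j   = fwd (added i≢j) ◅ ε , ≤-reflexive (+-identityʳ _)

    shortcutWalk⁻¹ : Σ[ p ∈ Walk G j i ] len p ≤ᵣ dist i j
    shortcutWalk⁻¹ = let p , p≤ = shortcutWalk ; q , q≈p = reverse p in
      q , ≤-trans (≤-reflexive q≈p) p≤

    -- An actual walk from u to v through a and b, with length at most |x_u - x_a| + |v_i v_j| +
    -- |x_b - x_v|.
    DetourWalk : Fin n → Fin n → Fin n → Fin n → Set (c Level.⊔ ℓ₂)
    DetourWalk a b u v = Σ[ p ∈ Walk G u v ] ∃₂ λ g h →
      Tight (x u) (x a) g × Tight (x b) (x v) h × len p ≤ᵣ g +ᵣ (dist i j +ᵣ h)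

    detourWalk : ∀ {a b} → Σ[ p ∈ Walk G a b ] len p ≤ᵣ dist i j →
                 ∀ u v → DetourWalk a b u v
    detourWalk {a} {b} (s , s≤d) u v = through (tightWalk u a) (tightWalk b v)
      where
      through : (Σ[ p ∈ Walk G u a ] Tight (x u) (x a) (len p)) →
                (Σ[ q ∈ Walk G b v ] Tight (x b) (x v) (len q)) → DetourWalk a b u v
      through (p , tp) (q , tq) = p ◅◅ (s ◅◅ q) , len p , len q , tp , tq ,
        ≤-trans (≤-reflexive (≈-trans (walkLength-◅◅ p _) (+-cong ≈-refl (walkLength-◅◅ s q))))
                (≤-refl +≤ s≤d +≤ ≤-refl)

    Detour : Fin n → Fin n → Fin n → Fin n → Carrier → Set (c Level.⊔ ℓ₂)
    Detour a b u v l = ∃₂ λ g h →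
      Near (x u) (x a) g × Near (x b) (x v) h × g +ᵣ (dist i j +ᵣ h) ≤ᵣ l

    -- A certificate that l is no less than the length of one of three routes: straight along the
    -- path, or once across the shortcut in either direction.
    data Crossing (a b u v : Fin n) (l : Carrier) : Set (c Level.⊔ ℓ₂) where
      along    : Near (x u) (x v) l → Crossing a b u v l
      forth    : Detour a b u v l   → Crossing a b u v l
      back     : Detour b a u v l   → Crossing a b u v l

    crossing-sym : ∀ {a b u v l} → Crossing a b u v l → Crossing b a u v l
    crossing-sym (along near) = along near
    crossing-sym (forth way)  = back way
    crossing-sym (back way)   = forth way

    prepend-detour : ∀ {a b u w v e l} → Near (x u) (x w) e →
                     Detour a b w v l → Detour a b u v (e +ᵣ l)
    prepend-detour {e = e} {l} u~w (g , h , w~a , b~v , len≤) =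
      e +ᵣ g , h , near-trans u~w w~a , b~v ,
      linear (e ∷ g ∷ dist i j ∷ h ∷ l ∷ [])
        (λ e g d h l → g ∙ (d ∙ h) ≼ l ⟹ (e ∙ g) ∙ (d ∙ h) ≼ e ∙ l) refl len≤

    prepend-step : ∀ {a b u w v e l} → Near (x u) (x w) e →
                   Crossing a b w v l → Crossing a b u v (e +ᵣ l)
    prepend-step u~w (along w~v) = along (near-trans u~w w~v)
    prepend-step u~w (forth way) = forth (prepend-detour u~w way)
    prepend-step u~w (back way)  = back (prepend-detour u~w way)

    -- If the rest of the walk already crosses the shortcut, a second crossing brings nothing: a
    -- straight route from a is no longer. Thus one crossing always suffices.
    prepend-shortcut : ∀ {a b v l} → Crossing a b b v l → Crossing a b a v (dist i j +ᵣ l)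
    prepend-shortcut {l = l} (along b~v) =
      forth (0# , l , near-refl , b~v , ≤-reflexive (+-identityˡ _))
    prepend-shortcut {l = l} (forth (g , h , b~a , b~v , len≤)) =
      along (near-mono
        (linear (dist i j ∷ g ∷ h ∷ l ∷ [])
          -- The hypothesis leaves g + h ≤ l - d; adding 0 ≤ d twice turns this into the weaker
          -- bound l + d.
          (λ d g h l → (g ∙ (d ∙ h)) ∙ id ∙ id ≼ l ∙ d ∙ d ⟹ g ∙ h ≼ d ∙ l)
          refl (len≤ +≤ nonNegative +≤ nonNegative))
        (near-trans (near-sym b~a) b~v))
    prepend-shortcut {l = l} (back (g , h , (b≤b+g , _) , a~v , len≤)) =
      along (near-mono
        (linear (dist i j ∷ g ∷ h ∷ l ∷ x _ ∷ [])
          (λ d g h l y → (g ∙ (d ∙ h)) ∙ id ∙ id ∙ y ≼ l ∙ d ∙ d ∙ (y ∙ g) ⟹ h ≼ d ∙ l)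
          refl (len≤ +≤ nonNegative +≤ nonNegative +≤ b≤b+g))
        a~v)

    near-step : ∀ {k l} → toℕ l ≡ suc (toℕ k) → Near (x k) (x l) (dist k l)
    near-step {k} {l} eq =
      linear (x k ∷ x l ∷ dist k l ∷ [])
        (λ k l d → (k ∙ d) ∙ id ∙ id ≼ l ∙ d ∙ d ⟹ k ≼ l ∙ d) refl
        (≤-reflexive (≈-sym (x-step eq)) +≤ nonNegative +≤ nonNegative) ,
      ≤-reflexive (x-step eq)

    crossing : ∀ {u v} (p : Walk G u v) → Crossing i j u v (len p)
    crossing ε                   = along near-refl
    crossing (fwd (path eq)  ◅ p) = prepend-step (near-step eq) (crossing p)
    crossing (bwd (path eq)  ◅ p) = prepend-step (near-sym (near-step eq)) (crossing p)
    crossing (fwd (added _)  ◅ p) = prepend-shortcut (crossing p)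
    crossing (bwd (added _)  ◅ p) =
      crossing-sym (prepend-shortcut (crossing-sym (crossing p)))

    detour≤ : ∀ {a b u v l} (w : DetourWalk a b u v) → Detour a b u v l → len (proj₁ w) ≤ᵣ l
    detour≤ (_ , g , h , tg , th , q≤) (g′ , h′ , ng , nh , ≤l) = ≤-trans q≤
      (≤-trans (tight≤near tg ng +≤ ≤-refl +≤ tight≤near th nh) ≤l)

    shorterOf : ∀ {u v} (p q : Walk G u v) →
                Σ[ s ∈ Walk G u v ] (len s ≤ᵣ len p × len s ≤ᵣ len q)
    shorterOf p q with ≤-total (len p) (len q)
    ... | inj₁ p≤q = p , ≤-refl , p≤q
    ... | inj₂ q≤p = q , q≤p , ≤-refl

    -- The infinitely many walks reduce to three candidates, the straight walk and the two detours:
    -- by `crossing`, every walk is at least as long as one of them.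
    shortest : ∀ u v → Σ[ p ∈ Walk G u v ] (∀ q → len p ≤ᵣ len q)
    shortest u v =
      choose (tightWalk u v) (detourWalk shortcutWalk u v) (detourWalk shortcutWalk⁻¹ u v)
      where
      choose : (Σ[ p ∈ Walk G u v ] Tight (x u) (x v) (len p)) →
               DetourWalk i j u v → DetourWalk j i u v →
               Σ[ p ∈ Walk G u v ] (∀ q → len p ≤ᵣ len q)
      choose (straight , tight) there thence
        with r , r≤there , r≤thence ← shorterOf (proj₁ there) (proj₁ thence)
        with p , p≤straight , p≤r ← shorterOf straight r
        = p , λ q → shorter (crossing q)
        where
        shorter : ∀ {l} → Crossing i j u v l → len p ≤ᵣ l
        shorter (along near) = ≤-trans p≤straight (tight≤near tight near)
        shorter (forth way)  = ≤-trans (≤-trans p≤r r≤there) (detour≤ there way)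
        shorter (back way)   = ≤-trans (≤-trans p≤r r≤thence) (detour≤ thence way)

    -- The diameter exists as a maximum over finitely many pairs; `u₀` witnesses that there are any.
    diameter≤ : ∀ {bound} → Fin n → (∀ u v → Σ[ p ∈ Walk G u v ] len p ≤ᵣ bound) →
                ∃[ D ] (IsDiameter G D × D ≤ᵣ bound)
    diameter≤ {bound} u₀ short = attain (maximum δ u₀)
      where
      δ : Fin n → Fin n → Carrier
      δ u v = len (proj₁ (shortest u v))

      attain : (∃₂ λ u v → ∀ u′ v′ → δ u′ v′ ≤ᵣ δ u v) → ∃[ D ] (IsDiameter G D × D ≤ᵣ bound)
      attain (u , v , δ≤) = δ u v ,
        (δ ,
         (λ u v → (proj₁ (shortest u v) , ≈-refl) ,
                  λ (q , q≈y) → ≤-trans (proj₂ (shortest u v) q) (≤-reflexive q≈y)) ,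
         (u , v , ≈-refl) ,
         λ (u′ , v′ , δ≈y) → ≤-trans (≤-reflexive (≈-sym δ≈y)) (δ≤ u′ v′)) ,
        ≤-trans (proj₂ (shortest u v) (proj₁ (short u v))) (proj₂ (short u v))

  -- Feasibility in terms of far pairs.

  Far : Carrier → Fin n → Fin n → Set ℓ₂
  Far bound k l = ¬ x l ≤ᵣ bound +ᵣ x k

  WithinFar : Carrier → Fin n → Fin n → Set ℓ₂
  WithinFar bound i j =
    ∀ {k l} → Far bound k l → Within bound (dist i j) (x i) (x j) (x k) (x l)

  x-slope : ∀ {u v} → u Fin.≤ v → x u +ᵣ dist u v ≤ᵣ x v
  -- The trivial shortcut from u to u adds no edge, so the walk stays on the path.
  x-slope {u} {v} u≤v = let p , x+p≤ = pathWalk {u} {u} u≤v in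
    ≤-trans (≤-refl +≤ dist≤walkLength p) x+p≤

  x-mono : ∀ {u v} → u Fin.≤ v → x u ≤ᵣ x v
  x-mono {u} {v} u≤v = ≤-trans (x≤x+y nonNegative) (x-slope u≤v)

  -- A far pair is joined by the detour through the shortcut, its reverse by the detour taken
  -- backwards, and any other pair by the path itself.
  within⇒feasible : ∀ {bound i j} → i Fin.≤ j → WithinFar bound i j → FeasibleEdge P bound i j
  within⇒feasible {bound} {i} {j} i≤j all = i≤j , diameter≤ i short
    where
    short : ∀ u v → Σ[ p ∈ Walk (augment P i j) u v ] walkLength (augment P i j) p ≤ᵣ bound
    short u v with x v ≤? bound +ᵣ x u | x u ≤? bound +ᵣ x v
    ... | no far | _ = let p , g , h , tg , th , p≤ = detourWalk shortcutWalk u v in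
      p , ≤-trans p≤ (within⇒detour≤ (all far) (swap tg) th)
    ... | yes _ | no far = let p , g , h , tg , th , p≤ = detourWalk shortcutWalk⁻¹ u v in
      p , ≤-trans p≤ (linear (dist i j ∷ g ∷ h ∷ bound ∷ [])
        (λ d g h m → h ∙ (d ∙ g) ≼ m ⟹ g ∙ (d ∙ h) ≼ m) refl
        (within⇒detour≤ (all far) th (swap tg)))
    ... | yes v≤ | yes u≤ = let p , tp = tightWalk u v in p , tight≤near tp
      (≤-trans u≤ (≤-reflexive (+-comm _ _)) , ≤-trans v≤ (≤-reflexive (+-comm _ _)))

  -- A shortest walk between a far pair cannot be as long as the straight route, so it is bounded
  -- below by a detour; a detour in the wrong direction is turned round by `within-swap`.
  feasible⇒within : ∀ {bound i j} → FeasibleEdge P bound i j → WithinFar bound i j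
  feasible⇒within {bound} {i} {j} (i≤j , D , (δ , isDistance , _ , δ≤D) , D≤) {k} {l} far
    with (p , p≈δ) , _ ← isDistance k l
    = within′ (crossing p)
    where
    p≤bound : walkLength (augment P i j) p ≤ᵣ bound
    p≤bound = ≤-trans (≤-reflexive p≈δ) (≤-trans (δ≤D (k , l , ≈-refl)) D≤)

    k≤l : x k ≤ᵣ x l
    k≤l = ≤-trans (x≤x+y 0≤bound) (≤-trans (≤-reflexive (+-comm _ _)) (≰⇒≥ far))
      -- Farness puts x_l beyond bound + x_k; that this is beyond x_k needs a nonnegative bound,
      -- which the length of `p` supplies.
      where
      0≤bound : 0# ≤ᵣ bound
      0≤bound = ≤-trans nonNegative (≤-trans (dist≤walkLength p) p≤bound)

    within′ : Crossing i j k l (walkLength (augment P i j) p) →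
              Within bound (dist i j) (x i) (x j) (x k) (x l)
    within′ (along (_ , l≤)) =
      contradiction (≤-trans l≤ (≤-trans (≤-refl +≤ p≤bound) (≤-reflexive (+-comm _ _)))) far
    within′ (forth (_ , _ , k~i , j~l , len≤)) =
      detour≤⇒within (≤-trans len≤ p≤bound) k~i j~l
    within′ (back (_ , _ , k~j , i~l , len≤)) =
      within-swap (x-mono i≤j) k≤l (detour≤⇒within (≤-trans len≤ p≤bound) k~j i~l)

-- Execution and running time of programs.

LoopFree : Program → Set
LoopFree skip                  = ⊤
LoopFree (nat⟨ _ ⟩[ _ ]≔ _)    = ⊤
LoopFree (real⟨ _ ⟩[ _ ]≔ _)   = ⊤
LoopFree (p ⨾ q)               = LoopFree p × LoopFree q
LoopFree (cond _ p q)          = LoopFree p × LoopFree q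
LoopFree (while _ _)           = ⊥

-- Junk on loops.
duration : Program → ℕ
duration skip                  = 1
duration (nat⟨ _ ⟩[ k ]≔ e)    = suc (natCost k + natCost e)
duration (real⟨ _ ⟩[ k ]≔ e)   = suc (natCost k + realCost e)
duration (p ⨾ q)               = duration p + duration q
duration (cond b p q)          = suc (testCost b + (duration p ⊔ duration q))
duration (while _ _)           = 0

iterationCost : Test → Program → ℕ
iterationCost b p = suc (testCost b + duration p)

-- The running time per unit of n of initialisation by p₀ followed by fewer
-- than r * n iterations.
loopRate : Program → Test → Program → ℕ → ℕ
loopRate p₀ b p r = duration p₀ + r * iterationCost b p

module Semantics {c ℓ₁ ℓ₂} (F : OrderedField c ℓ₁ ℓ₂)
                 (oracle : ℕ → ℕ → OrderedField.Carrier F) where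
  open OrderedField F
  open OverField F
  open Execution oracle

  update-same : ∀ {ℓ} {A : Set ℓ} (m : ℕ → ℕ → A) a k x → (m [ a , k ]≔ x) a k ≡ x
  update-same m a k x rewrite dec-true (a ℕₚ.≟ a) refl | dec-true (k ℕₚ.≟ k) refl = refl

  update-other : ∀ {ℓ} {A : Set ℓ} (m : ℕ → ℕ → A) a {k l} x → k ≢ l →
                 (m [ a , k ]≔ x) a l ≡ m a l
  update-other m a {k} {l} x k≢l
    rewrite dec-true (a ℕₚ.≟ a) refl | dec-false (k ℕₚ.≟ l) k≢l = refl

  -- Junk on loops.
  exec : Program → Store → Store
  exec skip                  σ = σ
  exec (nat⟨ a ⟩[ k ]≔ e)    σ = store (nats σ [ a , evalNat k σ ]≔ evalNat e σ) (reals σ)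
  exec (real⟨ a ⟩[ k ]≔ e)   σ = store (nats σ) (reals σ [ a , evalNat k σ ]≔ evalReal e σ)
  exec (p ⨾ q)               σ = exec q (exec p σ)
  exec (cond b p q)          σ = if evalTest b σ then exec p σ else exec q σ
  exec (while _ _)           σ = σ

  Reaches : ∀ {ℓ} → Program → Store → ℕ → (Store → Set ℓ) → Set (c Level.⊔ ℓ)
  Reaches p σ T Q = ∃₂ λ t τ → (⟨ p , σ ⟩⇓[ t ] τ) × t ≤ T × Q τ

  reaches-mono : ∀ {ℓ} {Q : Store → Set ℓ} {p σ T T′} → T ≤ T′ → Reaches p σ T Q → Reaches p σ T′ Q
  reaches-mono T≤T′ (t , τ , run , t≤T , q) = t , τ , run , ℕₚ.≤-trans t≤T T≤T′ , q

  reaches-map : ∀ {ℓ ℓ′} {Q : Store → Set ℓ} {R : Store → Set ℓ′} → (∀ {τ} → Q τ → R τ) →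
                ∀ {p σ T} → Reaches p σ T Q → Reaches p σ T R
  reaches-map f (t , τ , run , t≤ , q) = t , τ , run , t≤ , f q

  -- Initialisations and loop bodies are loop-free, so their effect is a function of the store and
  -- their time is bounded independently of it.
  exec-runs : ∀ p → LoopFree p → ∀ σ → ∃ λ t → (⟨ p , σ ⟩⇓[ t ] exec p σ) × t ≤ duration p
  exec-runs skip                 _ σ = 1 , ⇓skip , ℕₚ.≤-refl
  exec-runs (nat⟨ _ ⟩[ _ ]≔ _)   _ σ = _ , ⇓nat , ℕₚ.≤-refl
  exec-runs (real⟨ _ ⟩[ _ ]≔ _)  _ σ = _ , ⇓real , ℕₚ.≤-refl
  exec-runs (p ⨾ q) (p-free , q-free) σ
    with s , p-runs , s≤ ← exec-runs p p-free σ
    with t , q-runs , t≤ ← exec-runs q q-free (exec p σ)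
    = s + t , ⇓seq p-runs q-runs , ℕₚ.+-mono-≤ s≤ t≤
  exec-runs (cond b p q) (p-free , q-free) σ with evalTest b σ in eq
  ... | true  = let t , p-runs , t≤ = exec-runs p p-free σ in
    _ , ⇓then eq p-runs ,
    s≤s (ℕₚ.+-monoʳ-≤ (testCost b) (ℕₚ.≤-trans t≤ (ℕₚ.m≤m⊔n _ _)))
  ... | false = let t , q-runs , t≤ = exec-runs q q-free σ in
    _ , ⇓else eq q-runs ,
    s≤s (ℕₚ.+-monoʳ-≤ (testCost b) (ℕₚ.≤-trans t≤ (ℕₚ.m≤n⊔m (duration p) _)))

  reaches-exec : ∀ {ℓ} {Q : Store → Set ℓ} p → LoopFree p → ∀ {σ} → Q (exec p σ) →
                 Reaches p σ (duration p) Q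
  reaches-exec p p-free {σ} q = let t , run , t≤ = exec-runs p p-free σ in
    t , exec p σ , run , t≤ , q

  reaches-seq : ∀ {ℓ ℓ′} {Q : Store → Set ℓ} {R : Store → Set ℓ′} {p q σ S T} →
                Reaches p σ S Q → (∀ {τ} → Q τ → Reaches q τ T R) →
                Reaches (p ⨾ q) σ (S + T) R
  reaches-seq (s , τ , p-runs , s≤ , Qτ) next with next Qτ
  ... | t , υ , q-runs , t≤ , Rυ = s + t , υ , ⇓seq p-runs q-runs , ℕₚ.+-mono-≤ s≤ t≤ , Rυ

  -- The propositional reading of tests, so that branches and loops hand over inequalities in place
  -- of Boolean equations.
  Truth : Test → Store → Set ℓ₂
  Truth (e ≤ℕ f)    σ = Level.Lift ℓ₂ (evalNat e σ ≤ evalNat f σ)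
  Truth (e ≤ℝ f)    σ = evalReal e σ ≤ᵣ evalReal f σ
  Truth (neg b)     σ = ¬ Truth b σ
  Truth (both b b′) σ = Truth b σ × Truth b′ σ

  truth? : ∀ b σ → Dec (Truth b σ)
  truth? (e ≤ℕ f)    σ = map′ Level.lift Level.lower (evalNat e σ ℕₚ.≤? evalNat f σ)
  truth? (e ≤ℝ f)    σ = evalReal e σ ≤? evalReal f σ
  truth? (neg b)     σ = ¬? (truth? b σ)
  truth? (both b b′) σ = truth? b σ ×-dec truth? b′ σ

  evalTest≡does : ∀ b σ → evalTest b σ ≡ does (truth? b σ)
  evalTest≡does (e ≤ℕ f)    σ = refl
  evalTest≡does (e ≤ℝ f)    σ = refl
  evalTest≡does (neg b)     σ = cong not (evalTest≡does b σ)
  evalTest≡does (both b b′) σ = cong₂ _∧_ (evalTest≡does b σ) (evalTest≡does b′ σ)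

  exec-cond : ∀ {ℓ} (Q : Store → Set ℓ) b p q {σ} →
              (Truth b σ → Q (exec p σ)) → (¬ Truth b σ → Q (exec q σ)) →
              Q (exec (cond b p q) σ)
  exec-cond Q b p q {σ} then′ else′ with truth? b σ | evalTest b σ | evalTest≡does b σ
  ... | yes holds | _ | refl = then′ holds
  ... | no fails  | _ | refl = else′ fails

  reaches-cond : ∀ {ℓ} {Q : Store → Set ℓ} b {p q σ T} →
                 (Truth b σ → Reaches p σ T Q) → (¬ Truth b σ → Reaches q σ T Q) →
                 Reaches (cond b p q) σ (suc (testCost b + T)) Q
  reaches-cond b {σ = σ} then′ else′ with truth? b σ in eq
  ... | yes holds = let t , τ , run , t≤ , Qτ = then′ holds in
    _ , τ , ⇓then (trans (evalTest≡does b σ) (cong does eq)) run ,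
    s≤s (ℕₚ.+-monoʳ-≤ (testCost b) t≤) , Qτ
  ... | no fails  = let t , τ , run , t≤ , Qτ = else′ fails in
    _ , τ , ⇓else (trans (evalTest≡does b σ) (cong does eq)) run ,
    s≤s (ℕₚ.+-monoʳ-≤ (testCost b) t≤) , Qτ

  module _ {ℓ} (b : Test) (p : Program) (p-free : LoopFree p)
           (measure : Store → ℕ) (Inv : Store → Set ℓ)
           (step : ∀ {σ} → Inv σ → Truth b σ →
                   Inv (exec p σ) × measure (exec p σ) < measure σ)
           where

    private
      -- At most m iterations run, since each lowers the measure; the extra one in the bound pays
      -- for the final failing test.
      loop : ∀ m {σ} → measure σ ≤ m → Inv σ →
             Reaches (while b p) σ (suc m * iterationCost b p) (λ τ → Inv τ × ¬ Truth b τ)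
      loop m {σ} ≤m inv with truth? b σ in eq
      ... | no fails = _ , σ , ⇓done (trans (evalTest≡does b σ) (cong does eq)) ,
        ℕₚ.≤-trans (s≤s (ℕₚ.m≤m+n (testCost b) (duration p))) (ℕₚ.m≤m+n _ _) , inv , fails
      loop m {σ} ≤m inv | yes holds with step inv holds | exec-runs p p-free σ
      loop zero ≤m inv | yes _ | _ , decreases | _ =
        contradiction (ℕₚ.≤-trans decreases ≤m) λ ()
      loop (suc m) {σ} ≤m inv | yes _ | inv′ , decreases | s , run , s≤
        with t , τ , rest , t≤ , final ← loop m (ℕₚ.≤-pred (ℕₚ.≤-trans decreases ≤m)) inv′
        = _ , τ , ⇓loop (trans (evalTest≡does b σ) (cong does eq)) run rest , time , final
        where
        time : suc (testCost b + (s + t)) ≤ suc (suc m) * iterationCost b p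
        time = ℕₚ.≤-trans (ℕₚ.≤-reflexive (cong suc (sym (ℕₚ.+-assoc (testCost b) s t))))
          (ℕₚ.+-mono-≤ (s≤s (ℕₚ.+-monoʳ-≤ (testCost b) s≤)) t≤)

    -- As n is nonzero, the constant cost of the initialisation is at most n times itself. The
    -- strict bound on the measure leaves room for the last test.
    reaches-while : ∀ p₀ → LoopFree p₀ → ∀ r n .{{_ : NonZero n}} {σ} →
                    measure (exec p₀ σ) < r * n → Inv (exec p₀ σ) →
                    Reaches (p₀ ⨾ while b p) σ (loopRate p₀ b p r * n) (λ τ → Inv τ × ¬ Truth b τ)
    reaches-while p₀ p₀-free r n {σ} <r*n inv
      with s , init , s≤ ← exec-runs p₀ p₀-free σ
      with t , τ , rest , t≤ , final ← loop _ ℕₚ.≤-refl inv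
      = s + t , τ , ⇓seq init rest , time , final
      where
      open ℕₚ.≤-Reasoning
      K = iterationCost b p
      time : s + t ≤ loopRate p₀ b p r * n
      time = begin
        s + t                                       ≤⟨ ℕₚ.+-mono-≤ s≤ t≤ ⟩
        duration p₀ + suc (measure (exec p₀ σ)) * K ≤⟨ ℕₚ.+-mono-≤ (ℕₚ.m≤m*n (duration p₀) n)
                                                                  (ℕₚ.*-monoˡ-≤ K <r*n) ⟩
        duration p₀ * n + r * n * K                 ≡⟨ cong (duration p₀ * n +_) (swapʳ r n K) ⟩
        duration p₀ * n + r * K * n                 ≡⟨ ℕₚ.*-distribʳ-+ n (duration p₀) (r * K) ⟨
        loopRate p₀ b p r * n                       ∎
        where
        swapʳ : ∀ x y z → x * y * z ≡ x * z * y
        swapʳ x y z = trans (ℕₚ.*-assoc x y z)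
          (trans (cong (x *_) (ℕₚ.*-comm y z)) (sym (ℕₚ.*-assoc x z y)))

-- Positions and shortcut lengths under natural indices, with `e` the last one.

module Search {c ℓ₁ ℓ₂} (F : OrderedField c ℓ₁ ℓ₂) {e} (P : OverField.MetricPath F (suc e))
              (bound : OrderedField.Carrier F)
              (X : ℕ → OrderedField.Carrier F)
              (X-suc : ∀ {m} → m < e → X (suc m) ≡
                       OrderedField._+ᵣ_ F (X m) (OverField.distanceOracle F P m (suc m)))
              where
  open OrderedField F
  open LinearArithmetic F
  open OverField F
  open MetricPath P
  open IsPreMetric isPreMetric using (nonNegative)

  private
    d : ℕ → ℕ → Carrier
    d = distanceOracle P

  oracle-dist : ∀ u v → d (toℕ u) (toℕ v) ≡ dist u v
  oracle-dist u v with toℕ u ℕₚ.<? suc e | toℕ v ℕₚ.<? suc e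
  ... | yes u< | yes v< = cong₂ dist (Finₚ.fromℕ<-toℕ u u<) (Finₚ.fromℕ<-toℕ v v<)
  ... | no u≮  | _      = contradiction (Finₚ.toℕ<n u) u≮
  ... | yes _  | no v≮  = contradiction (Finₚ.toℕ<n v) v≮

  x-step : ∀ {k l : Fin (suc e)} → toℕ l ≡ suc (toℕ k) → X (toℕ l) ≈ X (toℕ k) +ᵣ dist k l
  x-step {k} {l} l≡ = ≡⇒≈ (trans (cong X l≡)
    (trans (X-suc (ℕₚ.≤-pred (subst (_< suc e) l≡ (Finₚ.toℕ<n l))))
      (cong (X (toℕ k) +ᵣ_) (trans (cong (d (toℕ k)) (sym l≡)) (oracle-dist k l)))))
    where
    open CommutativeRing commutativeRing using () renaming (reflexive to ≡⇒≈)

  open Shortcut F P (λ u → X (toℕ u)) x-step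
    using (x-slope; x-mono; within⇒feasible; feasible⇒within)

  -- The machine addresses cells by naturals; matching on this equation moves facts about `Fin` to
  -- such indices.
  vertex : ∀ {m} → m ≤ e → ∃[ u ] toℕ {suc e} u ≡ m
  vertex m≤e = fromℕ< (s≤s m≤e) , Finₚ.toℕ-fromℕ< (s≤s m≤e)

  d-sym : ∀ {u v} → u ≤ e → v ≤ e → d u v ≈ d v u
  d-sym u≤e v≤e with vertex u≤e | vertex v≤e
  ... | u , refl | v , refl rewrite oracle-dist u v | oracle-dist v u = symmetric u v

  d-triangle : ∀ {u v w} → u ≤ e → v ≤ e → w ≤ e → d u w ≤ᵣ d u v +ᵣ d v w
  d-triangle u≤e v≤e w≤e with vertex u≤e | vertex v≤e | vertex w≤e
  ... | u , refl | v , refl | w , refl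
    rewrite oracle-dist u w | oracle-dist u v | oracle-dist v w = triangle u v w

  d-nonNegative : ∀ {u v} → u ≤ e → v ≤ e → 0# ≤ᵣ d u v
  d-nonNegative u≤e v≤e with vertex u≤e | vertex v≤e
  ... | u , refl | v , refl rewrite oracle-dist u v = nonNegative

  X-slope : ∀ {u v} → u ≤ v → v ≤ e → X u +ᵣ d u v ≤ᵣ X v
  X-slope u≤v v≤e with vertex (ℕₚ.≤-trans u≤v v≤e) | vertex v≤e
  ... | u , refl | v , refl rewrite oracle-dist u v = x-slope {u} {v} u≤v

  X-mono : ∀ {u v} → u ≤ v → v ≤ e → X u ≤ᵣ X v
  X-mono u≤v v≤e = ≤-trans (x≤x+y (d-nonNegative (ℕₚ.≤-trans u≤v v≤e) v≤e)) (X-slope u≤v v≤e)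

  -- By the triangle inequality, moving an end of the shortcut along the path
  -- changes its length by no more than the distance moved.
  rise : ∀ {i j j′} → i ≤ e → j ≤ j′ → j′ ≤ e → X j +ᵣ d i j′ ≤ᵣ X j′ +ᵣ d i j
  rise {i} {j} {j′} i≤e j≤j′ j′≤e =
    linear (X j ∷ X j′ ∷ d i j ∷ d i j′ ∷ d j j′ ∷ [])
      (λ x x′ l l′ m → (x ∙ m) ∙ l′ ≼ x′ ∙ (l ∙ m) ⟹ x ∙ l′ ≼ x′ ∙ l) refl
      (X-slope j≤j′ j′≤e +≤ d-triangle i≤e (ℕₚ.≤-trans j≤j′ j′≤e) j′≤e)

  fall : ∀ {i j j′} → i ≤ e → j ≤ j′ → j′ ≤ e → X j +ᵣ d i j ≤ᵣ X j′ +ᵣ d i j′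
  fall {i} {j} {j′} i≤e j≤j′ j′≤e =
    linear (X j ∷ X j′ ∷ d i j ∷ d i j′ ∷ d j j′ ∷ [])
      (λ x x′ l l′ m → (x ∙ m) ∙ l ≼ x′ ∙ (l′ ∙ m) ⟹ x ∙ l ≼ x′ ∙ l′) refl
      (X-slope j≤j′ j′≤e +≤ ≤-trans (d-triangle i≤e j′≤e j≤e)
        (≤-refl +≤ ≤-reflexive (d-sym j′≤e j≤e)))
    where j≤e = ℕₚ.≤-trans j≤j′ j′≤e

  -- `rise` and `fall` move the second end of the shortcut; by symmetry of the distance they also
  -- serve for the first.
  flip-d : ∀ {i j x y k} → i ≤ e → j ≤ e → k ≤ e →
           x +ᵣ d j i ≤ᵣ y +ᵣ d j k → x +ᵣ d i j ≤ᵣ y +ᵣ d k j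
  flip-d i≤e j≤e k≤e h = ≤-trans (≤-refl +≤ ≤-reflexive (d-sym i≤e j≤e))
    (≤-trans h (≤-refl +≤ ≤-reflexive (d-sym j≤e k≤e)))

  IsFar : ℕ → ℕ → Set ℓ₂
  IsFar k l = ¬ X l ≤ᵣ bound +ᵣ X k

  far-mono : ∀ {k k′ l l′} → k′ ≤ k → k ≤ e → l ≤ l′ → l′ ≤ e → IsFar k l → IsFar k′ l′
  far-mono k′≤k k≤e l≤l′ l′≤e far near =
    far (≤-trans (X-mono l≤l′ l′≤e) (≤-trans near (≤-refl +≤ X-mono k′≤k k≤e)))

  -- The common form of the inequalities of `Within`: below is `Fits i j i j k l`, above
  -- `Fits i j k l i j`, wide `Fits i j i l j k` and narrow `Fits i j j k i l`.
  Fits : (i j a b a′ b′ : ℕ) → Set ℓ₂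
  Fits i j a b a′ b′ = (X a +ᵣ X b) +ᵣ d i j ≤ᵣ bound +ᵣ (X a′ +ᵣ X b′)

  module _ {i j k l : ℕ} where
    -- The arrows give the direction in which a constraint persists. Where X of the moving end is on
    -- the left, `fall` absorbs the change of length; where it is on the right, `rise` does.
    below-↓ : ∀ {j′} → i ≤ e → j′ ≤ j → j ≤ e → Fits i j i j k l → Fits i j′ i j′ k l
    below-↓ {j′} i≤e j′≤j j≤e fits =
      linear (X i ∷ X j ∷ X j′ ∷ d i j ∷ d i j′ ∷ bound +ᵣ (X k +ᵣ X l) ∷ [])
        (λ a b b′ l l′ m → ((a ∙ b) ∙ l) ∙ (b′ ∙ l′) ≼ m ∙ (b ∙ l) ⟹ (a ∙ b′) ∙ l′ ≼ m) refl
        (fits +≤ fall i≤e j′≤j j≤e)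

    narrow-↓ : ∀ {j′} → i ≤ e → j′ ≤ j → j ≤ e → Fits i j j k i l → Fits i j′ j′ k i l
    narrow-↓ {j′} i≤e j′≤j j≤e fits =
      linear (X k ∷ X j ∷ X j′ ∷ d i j ∷ d i j′ ∷ bound +ᵣ (X i +ᵣ X l) ∷ [])
        (λ a b b′ l l′ m → ((b ∙ a) ∙ l) ∙ (b′ ∙ l′) ≼ m ∙ (b ∙ l) ⟹ (b′ ∙ a) ∙ l′ ≼ m) refl
        (fits +≤ fall i≤e j′≤j j≤e)

    above-↑ʳ : ∀ {j′} → i ≤ e → j ≤ j′ → j′ ≤ e → Fits i j k l i j → Fits i j′ k l i j′
    above-↑ʳ {j′} i≤e j≤j′ j′≤e fits =
      linear (X i ∷ X j ∷ X j′ ∷ d i j ∷ d i j′ ∷ bound ∷ X k +ᵣ X l ∷ [])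
        (λ a b b′ l l′ m s → (s ∙ l) ∙ (b ∙ l′) ≼ (m ∙ (a ∙ b)) ∙ (b′ ∙ l) ⟹ s ∙ l′ ≼ m ∙ (a ∙ b′))
        refl (fits +≤ rise i≤e j≤j′ j′≤e)

    above-↑ˡ : ∀ {i′} → i ≤ i′ → i′ ≤ e → j ≤ e → Fits i j k l i j → Fits i′ j k l i′ j
    above-↑ˡ {i′} i≤i′ i′≤e j≤e fits =
      linear (X j ∷ X i ∷ X i′ ∷ d i j ∷ d i′ j ∷ bound ∷ X k +ᵣ X l ∷ [])
        (λ a b b′ l l′ m s → (s ∙ l) ∙ (b ∙ l′) ≼ (m ∙ (b ∙ a)) ∙ (b′ ∙ l) ⟹ s ∙ l′ ≼ m ∙ (b′ ∙ a))
        refl (fits +≤ flip-d i′≤e j≤e (ℕₚ.≤-trans i≤i′ i′≤e) (rise j≤e i≤i′ i′≤e))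

    wide-↑ : ∀ {j′} → i ≤ e → j ≤ j′ → j′ ≤ e → Fits i j i l j k → Fits i j′ i l j′ k
    wide-↑ {j′} i≤e j≤j′ j′≤e fits =
      linear (X k ∷ X j ∷ X j′ ∷ d i j ∷ d i j′ ∷ bound ∷ X i +ᵣ X l ∷ [])
        (λ a b b′ l l′ m s → (s ∙ l) ∙ (b ∙ l′) ≼ (m ∙ (b ∙ a)) ∙ (b′ ∙ l) ⟹ s ∙ l′ ≼ m ∙ (b′ ∙ a))
        refl (fits +≤ rise i≤e j≤j′ j′≤e)

    wide-↓ : ∀ {i′} → i′ ≤ i → i ≤ e → j ≤ e → Fits i j i l j k → Fits i′ j i′ l j k
    wide-↓ {i′} i′≤i i≤e j≤e fits =
      linear (X l ∷ X i ∷ X i′ ∷ d i j ∷ d i′ j ∷ bound +ᵣ (X j +ᵣ X k) ∷ [])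
        (λ a b b′ l l′ m → ((b ∙ a) ∙ l) ∙ (b′ ∙ l′) ≼ m ∙ (b ∙ l) ⟹ (b′ ∙ a) ∙ l′ ≼ m) refl
        (fits +≤ flip-d (ℕₚ.≤-trans i′≤i i≤e) j≤e i≤e (fall j≤e i′≤i i≤e))

  -- Extremal far pairs and the two-pointer scan.

  module _ (k a b : ℕ) where
    -- That the pair is far makes its constraint necessary, and minimality makes it sufficient for
    -- all far pairs with first index below k. The pair itself may start at k or later, as the
    -- initial one does.
    record MinSum : Set ℓ₂ where
      constructor minSum
      field
        first≤e  : a ≤ e
        second≤e : b ≤ e
        isFar    : IsFar a b
        minimal  : ∀ {k′ l′} → k′ < k → k′ ≤ e → l′ ≤ e → IsFar k′ l′ → X a +ᵣ X b ≤ᵣ X k′ +ᵣ X l′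

    -- Minimality of X b - X a, with the differences cross-added.
    record MinGap : Set ℓ₂ where
      constructor minGap
      field
        first≤e  : a ≤ e
        second≤e : b ≤ e
        isFar    : IsFar a b
        minimal  : ∀ {k′ l′} → k′ < k → k′ ≤ e → l′ ≤ e → IsFar k′ l′ → X k′ +ᵣ X b ≤ᵣ X a +ᵣ X l′

  -- Moving the second end to `e` keeps a pair far and does not lower the sum, so only the first end
  -- is recorded.
  record MaxSum (k a : ℕ) : Set ℓ₂ where
    constructor maxSum
    field
      first≤e : a ≤ e
      isFar   : IsFar a e
      maximal : ∀ {k′} → k′ < k → k′ ≤ e → X k′ ≤ᵣ X a

  -- The two-pointer invariant: far partners of k lie at l or beyond. The guard matters once k has
  -- passed `e`, where `X` is unconstrained.
  Unreached : ℕ → ℕ → Set ℓ₂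
  Unreached k l = k ≤ e → ∀ {l′} → l′ < l → X l′ ≤ᵣ bound +ᵣ X k

  unreached-sucˡ : ∀ {k l} → Unreached k l → Unreached (suc k) l
  unreached-sucˡ {k} unreached k<e l′<l =
    ≤-trans (unreached (ℕₚ.<⇒≤ k<e) l′<l) (≤-refl +≤ X-mono (ℕₚ.n≤1+n k) k<e)

  unreached-sucʳ : ∀ {k l} → X l ≤ᵣ bound +ᵣ X k → Unreached k l → Unreached k (suc l)
  unreached-sucʳ Xl≤ unreached k≤e l′<1+l with ℕₚ.m<1+n⇒m<n∨m≡n l′<1+l
  ... | inj₁ l′<l = unreached k≤e l′<l
  ... | inj₂ refl = Xl≤

  module _ {k l : ℕ} (unreached : Unreached k l) (k≤e : k ≤ e) where

    private
      -- Among the far pairs starting at k, all have second position at least X l, so comparing with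
      -- `(k , l)` accounts for all of them.
      extend : (Q : ℕ → ℕ → Set ℓ₂) →
               (∀ {k′ l′} → k′ < k → k′ ≤ e → l′ ≤ e → IsFar k′ l′ → Q k′ l′) →
               (∀ {l′} → X l ≤ᵣ X l′ → Q k l′) →
               ∀ {k′ l′} → k′ < suc k → k′ ≤ e → l′ ≤ e → IsFar k′ l′ → Q k′ l′
      extend Q old new k′<1+k k′≤e l′≤e far with ℕₚ.m<1+n⇒m<n∨m≡n k′<1+k
      ... | inj₁ k′<k = old k′<k k′≤e l′≤e far
      ... | inj₂ refl = new (X-mono (ℕₚ.≮⇒≥ λ l′<l → far (unreached k≤e l′<l)) l′≤e)

    minSum-keep : ∀ {a b} → ¬ X k +ᵣ X l ≤ᵣ X a +ᵣ X b → MinSum k a b → MinSum (suc k) a b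
    minSum-keep {a} {b} ≰ (minSum a≤e b≤e far min) = minSum a≤e b≤e far
      (extend (λ k′ l′ → X a +ᵣ X b ≤ᵣ X k′ +ᵣ X l′) min
        λ l≤l′ → ≤-trans (≰⇒≥ ≰) (≤-refl +≤ l≤l′))

    minSum-replace : ∀ {a b} → l ≤ e → IsFar k l → X k +ᵣ X l ≤ᵣ X a +ᵣ X b →
                     MinSum k a b → MinSum (suc k) k l
    minSum-replace l≤e far kl≤ab (minSum _ _ _ min) = minSum k≤e l≤e far
      (extend (λ k′ l′ → X k +ᵣ X l ≤ᵣ X k′ +ᵣ X l′)
        (λ k′<k k′≤e l′≤e far′ → ≤-trans kl≤ab (min k′<k k′≤e l′≤e far′))
        λ l≤l′ → ≤-refl +≤ l≤l′)

    minGap-keep : ∀ {a b} → ¬ X a +ᵣ X l ≤ᵣ X k +ᵣ X b → MinGap k a b → MinGap (suc k) a b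
    minGap-keep {a} {b} ≰ (minGap a≤e b≤e far min) = minGap a≤e b≤e far
      (extend (λ k′ l′ → X k′ +ᵣ X b ≤ᵣ X a +ᵣ X l′) min
        λ l≤l′ → ≤-trans (≰⇒≥ ≰) (≤-refl +≤ l≤l′))

    minGap-replace : ∀ {a b} → l ≤ e → IsFar k l → X a +ᵣ X l ≤ᵣ X k +ᵣ X b →
                     MinGap k a b → MinGap (suc k) k l
    minGap-replace {a} {b} l≤e far al≤kb (minGap _ _ _ min) = minGap k≤e l≤e far
      (extend (λ k′ l′ → X k′ +ᵣ X l ≤ᵣ X k +ᵣ X l′)
        (λ {k′} {l′} k′<k k′≤e l′≤e far′ →
          linear (X k ∷ X l ∷ X a ∷ X b ∷ X k′ ∷ X l′ ∷ [])
            (λ k l a b k′ l′ → (a ∙ l) ∙ (k′ ∙ b) ≼ (k ∙ b) ∙ (a ∙ l′) ⟹ k′ ∙ l ≼ k ∙ l′) refl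
            (al≤kb +≤ min k′<k k′≤e l′≤e far′))
        λ l≤l′ → ≤-refl +≤ l≤l′)

    maxSum-replace : ∀ {a} → l ≤ e → IsFar k l → MaxSum k a → MaxSum (suc k) k
    maxSum-replace l≤e far _ =
      maxSum k≤e (far-mono ℕₚ.≤-refl k≤e l≤e ℕₚ.≤-refl far) λ k′<1+k _ →
        X-mono (ℕₚ.≤-pred k′<1+k) k≤e

  -- The sweep over candidate shortcuts.

  record Corners : Set where
    constructor corners
    field
      a₁ a₂ h₁ h₂ b₁ : ℕ

  module _ (κ : Corners) where
    open Corners κ

    record Extremal (k : ℕ) : Set ℓ₂ where
      constructor extremal
      field
        sum-min : MinSum k a₁ a₂
        gap-min : MinGap k h₁ h₂
        sum-max : MaxSum k b₁

    -- The pair of greatest difference is always `(0 , e)`, and that of greatest sum ends in `e`;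
    -- hence five stored indices suffice for four pairs.
    record FitsCorners (i j : ℕ) : Set ℓ₂ where
      constructor fitsCorners
      field
        below  : Fits i j i j a₁ a₂
        above  : Fits i j b₁ e i j
        wide   : Fits i j i e j 0
        narrow : Fits i j j h₁ i h₂

    -- With growing i, meeting `above` and violating `wide` both persist. So p only moves down and q
    -- only up, which makes the sweep linear. The value `suc e` of p means that no index is yet
    -- known to meet `above`.
    record Swept (i p q : ℕ) : Set (c Level.⊔ ℓ₁ Level.⊔ ℓ₂) where
      constructor swept
      field
        p≤1+e : p ≤ suc e
        upper : i ≤ e → ∀ {j} → p ≤ j → j ≤ e → Fits i j b₁ e i j
        lower : i ≤ e → ∀ {j} → j < q → j ≤ e → ¬ Fits i j i e j 0
        none  : ∀ {i′ j} → i′ < i → i′ ≤ e → j ≤ e → ¬ FitsCorners i′ j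

    swept-start : Swept 0 (suc e) 0
    swept-start = swept ℕₚ.≤-refl
      (λ _ e<j j≤e → contradiction (ℕₚ.≤-trans e<j j≤e) (ℕₚ.n≮n e)) (λ _ ()) (λ ())

    swept-lower-p : ∀ {i p q} → 1 ≤ p → Fits i (p ∸ 1) b₁ e i (p ∸ 1) →
                    Swept i p q → Swept i (p ∸ 1) q
    swept-lower-p {p = suc p} _ fits (swept p<1+e upper lower none) =
      swept (ℕₚ.<⇒≤ p<1+e) (λ i≤e p≤j j≤e → above-↑ʳ i≤e p≤j j≤e fits) lower none

    swept-raise-q : ∀ {i p q} → q ≤ e → ¬ Fits i q i e q 0 → Swept i p q → Swept i p (suc q)
    swept-raise-q q≤e ¬fits (swept p≤1+e upper lower none) =
      swept p≤1+e upper (λ i≤e j<1+q _ fits → ¬fits (wide-↑ i≤e (ℕₚ.≤-pred j<1+q) q≤e fits)) none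

    -- At the first index max p q = p + (q ∸ p) that satisfies the two constraints
    -- closed upwards, the two closed downwards are easiest to meet.
    module _ {i p q : ℕ} (i≤e : i ≤ e) (sweep : Swept i p q)
             (p-done : 1 ≤ p → ¬ Fits i (p ∸ 1) b₁ e i (p ∸ 1))
             (q-done : q ≤ e → Fits i q i e q 0) where
      open Swept sweep

      private
        r = p + (q ∸ p)

        r-least : ∀ {j} → j ≤ e → FitsCorners i j → r ≤ j
        r-least {j} j≤e (fitsCorners _ above wide _) = ℕₚ.≤-trans
          (ℕₚ.+-monoʳ-≤ p (ℕₚ.∸-monoˡ-≤ p q≤j)) (ℕₚ.≤-reflexive (ℕₚ.m+[n∸m]≡n p≤j))
          where
          q≤j : q ≤ j
          q≤j = ℕₚ.≮⇒≥ λ j<q → lower i≤e j<q j≤e wide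

          p≤j : p ≤ j
          -- If some j below p met `above`, then so would p - 1, at which p would have been lowered.
          p≤j = ℕₚ.≮⇒≥ λ j<p → p-done (ℕₚ.≤-trans (s≤s z≤n) j<p)
            (above-↑ʳ i≤e (ℕₚ.∸-monoˡ-≤ 1 j<p) (ℕₚ.∸-monoˡ-≤ 1 p≤1+e) above)

      fits-found : r ≤ e → Fits i r i r a₁ a₂ → Fits i r r h₁ i h₂ → FitsCorners i r
      fits-found r≤e below narrow = fitsCorners below
        (upper i≤e (ℕₚ.m≤m+n p _) r≤e)
        (wide-↑ i≤e q≤r r≤e (q-done (ℕₚ.≤-trans q≤r r≤e)))
        narrow
        where
        q≤r = ℕₚ.m≤n+m∸n q p

      swept-suc : (r ≤ e → Fits i r i r a₁ a₂ → ¬ Fits i r r h₁ i h₂) → Swept (suc i) p q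
      swept-suc ¬found = swept p≤1+e
        (λ i<e p≤j j≤e → above-↑ˡ (ℕₚ.n≤1+n i) i<e j≤e (upper i≤e p≤j j≤e))
        (λ i<e j<q j≤e fits → lower i≤e j<q j≤e (wide-↓ (ℕₚ.n≤1+n i) i<e j≤e fits))
        none′
        where
        none′ : ∀ {i′ j} → i′ < suc i → i′ ≤ e → j ≤ e → ¬ FitsCorners i′ j
        none′ i′<1+i i′≤e j≤e fits with ℕₚ.m<1+n⇒m<n∨m≡n i′<1+i
        ... | inj₁ i′<i = none i′<i i′≤e j≤e fits
        ... | inj₂ refl = let r≤j = r-least j≤e fits in
          -- Whatever fits has j at least r, and `below` and `narrow` carry down from j to r, so r
          -- would have passed the test.
          ¬found (ℕₚ.≤-trans r≤j j≤e) (below-↓ i≤e r≤j j≤e (FitsCorners.below fits))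
                                      (narrow-↓ i≤e r≤j j≤e (FitsCorners.narrow fits))

  -- If the scan stops because l has passed `e`, no vertex from k on has a far partner.
  unreached⇒< : ∀ {k l} → Unreached k l → e < k ⊎ e < l →
                ∀ {k′ l′} → k′ ≤ e → l′ ≤ e → IsFar k′ l′ → k′ < k
  unreached⇒< unreached (inj₁ e<k) k′≤e l′≤e far = ℕₚ.≤-<-trans k′≤e e<k
  unreached⇒< unreached (inj₂ e<l) k′≤e l′≤e far = ℕₚ.≰⇒> λ k≤k′ →
    far (≤-trans (unreached (ℕₚ.≤-trans k≤k′ k′≤e) (ℕₚ.≤-<-trans l′≤e e<l))
                 (≤-refl +≤ X-mono k≤k′ k′≤e))

  -- The four corner constraints characterise feasibility.

  within-dist : ∀ u v {k l} →
    Within bound (d (toℕ u) (toℕ v)) (X (toℕ u)) (X (toℕ v)) (X k) (X l) ≡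
    Within bound (dist u v) (X (toℕ u)) (X (toℕ v)) (X k) (X l)
  within-dist u v = cong (λ l → Within bound l _ _ _ _) (oracle-dist u v)

  feasible⇒within-d : ∀ {u v} → FeasibleEdge P bound u v → ∀ {k l} → k ≤ e → l ≤ e → IsFar k l →
                      Within bound (d (toℕ u) (toℕ v)) (X (toℕ u)) (X (toℕ v)) (X k) (X l)
  feasible⇒within-d {u} {v} feasible k≤e l≤e far with vertex k≤e | vertex l≤e
  ... | k , refl | l , refl =
    subst (λ m → m) (sym (within-dist u v)) (feasible⇒within feasible {k} {l} far)

  feasible⇒fitsCorners : ∀ {κ k u v} → Extremal κ k → IsFar 0 e → FeasibleEdge P bound u v →
                         FitsCorners κ (toℕ u) (toℕ v)
  feasible⇒fitsCorners
    (extremal (minSum a₁≤e a₂≤e a-far _) (minGap h₁≤e h₂≤e h-far _) (maxSum b₁≤e b-far _))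
    0-far feasible = fitsCorners
      (Within.below (feasible⇒within-d feasible a₁≤e a₂≤e a-far))
      (Within.above (feasible⇒within-d feasible b₁≤e ℕₚ.≤-refl b-far))
      (Within.wide (feasible⇒within-d feasible z≤n ℕₚ.≤-refl 0-far))
      (Within.narrow (feasible⇒within-d feasible h₁≤e h₂≤e h-far))

  -- The search does not order the ends. Were j below i, the wide constraint would already put x_e
  -- within the bound of x_0.
  fitsCorners⇒≤ : ∀ {κ i j} → i ≤ e → j ≤ e → IsFar 0 e → FitsCorners κ i j → i ≤ j
  fitsCorners⇒≤ {i = i} {j} i≤e j≤e 0-far (fitsCorners _ _ wide _) = ℕₚ.≮⇒≥ λ j<i →
    0-far (linear (X i ∷ X j ∷ X e ∷ X 0 ∷ d i j ∷ bound ∷ [])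
      (λ a b q o l m → ((a ∙ q) ∙ l) ∙ (b ∙ id) ≼ (m ∙ (b ∙ o)) ∙ (a ∙ l) ⟹ q ≼ m ∙ o) refl
      (wide +≤ X-mono (ℕₚ.<⇒≤ j<i) i≤e +≤ d-nonNegative i≤e j≤e))

  -- Each inequality for an arbitrary far pair follows from the same inequality at its extremal
  -- pair.
  fitsCorners⇒feasible : ∀ {κ k i j} → Extremal κ k →
    (∀ {k′ l′} → k′ ≤ e → l′ ≤ e → IsFar k′ l′ → k′ < k) → IsFar 0 e →
    i ≤ e → j ≤ e → FitsCorners κ i j →
    ∃₂ λ u v → FeasibleEdge P bound u v × i ≡ toℕ u × j ≡ toℕ v
  fitsCorners⇒feasible {κ} {k} (extremal sum-min gap-min sum-max) covered 0-far i≤e j≤e fits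
    with vertex i≤e | vertex j≤e
  ... | u , refl | v , refl =
    u , v ,
    within⇒feasible (fitsCorners⇒≤ i≤e j≤e 0-far fits) (λ {k′} {l′} → within′ k′ l′) ,
    refl , refl
    where
    open Corners κ
    open FitsCorners fits
    i = toℕ u
    j = toℕ v

    within′ : ∀ k′ l′ → IsFar (toℕ k′) (toℕ l′) →
              Within bound (dist u v) (X i) (X j) (X (toℕ k′)) (X (toℕ l′))
    within′ k′ l′ far = subst (λ m → m) (within-dist u v) (within
      (≤-trans below (≤-refl +≤ MinSum.minimal sum-min k′<k k′≤e l′≤e far))
      (≤-trans ((MaxSum.maximal sum-max k′<k k′≤e +≤ X-mono l′≤e ℕₚ.≤-refl) +≤ ≤-refl) above)
      (linear (X i ∷ X j ∷ X p ∷ X q ∷ X 0 ∷ X e ∷ d i j ∷ bound ∷ [])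
        (λ a b p q o z l m → ((a ∙ z) ∙ l) ∙ (o ∙ q) ≼ (m ∙ (b ∙ o)) ∙ (p ∙ z) ⟹
          (a ∙ q) ∙ l ≼ m ∙ (b ∙ p)) refl
        (wide +≤ X-mono z≤n k′≤e +≤ X-mono l′≤e ℕₚ.≤-refl))
      (linear (X i ∷ X j ∷ X p ∷ X q ∷ X h₁ ∷ X h₂ ∷ d i j ∷ bound ∷ [])
        (λ a b p q h h′ l m → ((b ∙ h) ∙ l) ∙ (p ∙ h′) ≼ (m ∙ (a ∙ h′)) ∙ (h ∙ q) ⟹
          (b ∙ p) ∙ l ≼ m ∙ (a ∙ q)) refl
        (narrow +≤ MinGap.minimal gap-min k′<k k′≤e l′≤e far)))
      where
      p = toℕ k′
      q = toℕ l′
      k′≤e = ℕₚ.≤-pred (Finₚ.toℕ<n k′)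
      l′≤e = ℕₚ.≤-pred (Finₚ.toℕ<n l′)
      k′<k = covered k′≤e l′≤e far

  -- If the two ends of the path are not far, no pair is, and the path alone will do.
  near⇒feasible : X e ≤ᵣ bound +ᵣ X 0 → FeasibleEdge P bound Fin.zero Fin.zero
  near⇒feasible near = within⇒feasible {i = Fin.zero} {Fin.zero} z≤n λ {k} {l} far →
    contradiction near (far-mono {toℕ k} {0} z≤n (ℕₚ.≤-pred (Finₚ.toℕ<n k))
                                 (ℕₚ.≤-pred (Finₚ.toℕ<n l)) ℕₚ.≤-refl far)

-- The program.

bound : RealExp
bound = real⟨ 0 ⟩[ lit 0 ]

position : NatExp → RealExp
position k = real⟨ 1 ⟩[ k ]

scalar : ℕ → NatExp
scalar m = nat⟨ 1 ⟩[ lit m ]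

infix 4 _≔_
_≔_ : ℕ → NatExp → Program
m ≔ k = nat⟨ 1 ⟩[ lit m ]≔ k

-- (a₁ , a₂) and (h₁ , h₂) are the far pairs of least sum and least difference
-- of positions found so far, (b₁ , last) that of greatest sum.  In the search,
-- the indices from p on meet, and those below q violate, the respective
-- upwards closed constraint on the second end of a shortcut from i.
last k l a₁ a₂ h₁ h₂ b₁ i p q : NatExp
last = scalar 0
k    = scalar 1
l    = scalar 2
a₁   = scalar 3
a₂   = scalar 4
h₁   = scalar 5
h₂   = scalar 6
b₁   = scalar 7
i    = scalar 8
p    = scalar 9
q    = scalar 10

answer : NatExp → NatExp → Program
answer u v = nat⟨ 0 ⟩[ lit 0 ]≔ lit 1 ⨾ nat⟨ 0 ⟩[ lit 1 ]≔ u ⨾ nat⟨ 0 ⟩[ lit 2 ]≔ v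

measuring : Test
measuring = lit 1 ⊞ k ≤ℕ last

measureStep : Program
measureStep =
  real⟨ 1 ⟩[ lit 1 ⊞ k ]≔ (position k ⊕ distance k (lit 1 ⊞ k)) ⨾ 1 ≔ lit 1 ⊞ k

-- Cell 0 of array 0 holds n at first and the verdict at the end, so it is cleared once n - 1 is
-- saved; the verdict then stays negative until a shortcut is found.
measureInit : Program
measureInit = 0 ≔ nat⟨ 0 ⟩[ lit 0 ] ⊟ lit 1 ⨾ 1 ≔ lit 0 ⨾ nat⟨ 0 ⟩[ lit 0 ]≔ lit 0

far : Test
far = neg (position last ≤ℝ bound ⊕ position (lit 0))

scanning : Test
scanning = both (k ≤ℕ last) (l ≤ℕ last)

recordSum recordGap advance scanStep : Program
recordSum = cond (position k ⊕ position l ≤ℝ position a₁ ⊕ position a₂) (3 ≔ k ⨾ 4 ≔ l) skip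
recordGap = cond (position h₁ ⊕ position l ≤ℝ position k ⊕ position h₂) (5 ≔ k ⨾ 6 ≔ l) skip
advance   = 7 ≔ k ⨾ 1 ≔ lit 1 ⊞ k
scanStep  = cond (position l ≤ℝ bound ⊕ position k) (2 ≔ lit 1 ⊞ l)
                 (recordSum ⨾ recordGap ⨾ advance)

scanInit : Program
scanInit = 1 ≔ lit 0 ⨾ 2 ≔ lit 0 ⨾ 3 ≔ lit 0 ⨾ 4 ≔ last ⨾ 5 ≔ lit 0 ⨾ 6 ≔ last ⨾ 7 ≔ lit 0

fits : (u v a b a′ b′ : NatExp) → Test
fits u v a b a′ b′ =
  (position a ⊕ position b) ⊕ distance u v ≤ℝ bound ⊕ (position a′ ⊕ position b′)

-- Subtraction is truncated, so this is the maximum of p and q.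
p⊔q : NatExp
p⊔q = p ⊞ (q ⊟ p)

searching : Test
searching = i ≤ℕ last

lowerable raisable found : Test
lowerable = both (lit 1 ≤ℕ p) (fits i (p ⊟ lit 1) b₁ last i (p ⊟ lit 1))
raisable  = both (q ≤ℕ last) (neg (fits i q i last q (lit 0)))
found     = both (p⊔q ≤ℕ last) (both (fits i p⊔q i p⊔q a₁ a₂) (fits i p⊔q p⊔q h₁ i h₂))

-- Each step makes one move, of p, q or i, which keeps the body loop-free. Success sends `i` past
-- `last` to end the loop.
tryAnswer tryRaise searchStep : Program
tryAnswer  = cond found (answer i p⊔q ⨾ 8 ≔ lit 1 ⊞ last) (8 ≔ lit 1 ⊞ i)
tryRaise   = cond raisable (10 ≔ lit 1 ⊞ q) tryAnswer
searchStep = cond lowerable (9 ≔ p ⊟ lit 1) tryRaise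

searchInit : Program
searchInit = 8 ≔ lit 0 ⨾ 9 ≔ lit 1 ⊞ last ⨾ 10 ≔ lit 0

measurePath scanFarPairs searchShortcut findShortcut : Program
measurePath    = measureInit ⨾ while measuring measureStep
scanFarPairs   = scanInit ⨾ while scanning scanStep
searchShortcut = searchInit ⨾ while searching searchStep
findShortcut   = measurePath ⨾ cond far (scanFarPairs ⨾ searchShortcut) (answer (lit 0) (lit 0))

-- The factors 1, 3 and 4 times n strictly exceed the initial measures n - 1, 2n and 3n of the three
-- loops.
measureRate scanRate searchRate answerTime findRate : ℕ
measureRate = loopRate measureInit measuring measureStep 1
scanRate    = loopRate scanInit scanning scanStep 3
searchRate  = loopRate searchInit searching searchStep 4
answerTime  = duration (answer (lit 0) (lit 0))
findRate    = measureRate + (suc (testCost far) + (scanRate + searchRate + answerTime))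

-- Correctness and running time of the program.

module Correctness {c ℓ₁ ℓ₂} (F : OrderedField c ℓ₁ ℓ₂) {e} (P : OverField.MetricPath F (suc e))
                   where
  open OrderedField F
  open OverField F
  open Semantics F (distanceOracle P)

  Correct : Carrier → Store → Set (c Level.⊔ ℓ₁ Level.⊔ ℓ₂)
  Correct λ₀ σ =
    (output σ 0 ≡ 1 ×
     ∃₂ λ u v → FeasibleEdge P λ₀ u v × output σ 1 ≡ toℕ u × output σ 2 ≡ toℕ v)
    ⊎ (output σ 0 ≡ 0 × ¬ Feasible P λ₀)

  module _ (λ₀ : Carrier) where

    record Measuring (σ : Store) : Set c where
      constructor measuring′
      field
        last≡  : nats σ 1 0 ≡ e
        out≡   : nats σ 0 0 ≡ 0
        bound≡ : reals σ 0 0 ≡ λ₀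
        x-suc  : ∀ {m} → m < nats σ 1 1 →
                 reals σ 1 (suc m) ≡ reals σ 1 m +ᵣ distanceOracle P m (suc m)

    unmeasured : Store → ℕ
    unmeasured σ = e ∸ nats σ 1 1

    measureStep-correct : ∀ {σ} → Measuring σ → Truth measuring σ →
                          Measuring (exec measureStep σ) ×
                          unmeasured (exec measureStep σ) < unmeasured σ
    measureStep-correct {σ} (measuring′ last≡ out≡ bound≡ x-suc) (Level.lift k<last) =
      measuring′ last≡ out≡ bound≡ x-suc′ ,
      ℕₚ.∸-monoʳ-< (ℕₚ.n<1+n _) (subst (suc (nats σ 1 1) ≤_) last≡ k<last)
      where
      τ = exec measureStep σ
      K = nats σ 1 1
      x′ = reals σ 1 K +ᵣ distanceOracle P K (suc K)
      unchanged : ∀ {m} → m ≤ K → reals τ 1 m ≡ reals σ 1 m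
      unchanged m≤K = update-other (reals σ) 1 x′ (ℕₚ.>⇒≢ (s≤s m≤K))
      x-suc′ : ∀ {m} → m < suc K → reals τ 1 (suc m) ≡ reals τ 1 m +ᵣ distanceOracle P m (suc m)
      x-suc′ {m} m<1+K with ℕₚ.m<1+n⇒m<n∨m≡n m<1+K
      ... | inj₁ m<K  = trans (unchanged m<K) (trans (x-suc m<K)
                          (cong (_+ᵣ distanceOracle P m (suc m)) (sym (unchanged (ℕₚ.<⇒≤ m<K)))))
      ... | inj₂ refl = trans (update-same (reals σ) 1 (suc K) x′)
                          (cong (_+ᵣ distanceOracle P K (suc K)) (sym (unchanged ℕₚ.≤-refl)))

    record Measured (σ : Store) : Set c where
      constructor measured
      field
        last≡  : nats σ 1 0 ≡ e
        out≡   : nats σ 0 0 ≡ 0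
        bound≡ : reals σ 0 0 ≡ λ₀
        x-suc  : ∀ {m} → m < e →
                 reals σ 1 (suc m) ≡ reals σ 1 m +ᵣ distanceOracle P m (suc m)

    measurePath-correct : Reaches measurePath (input (suc e) λ₀) (measureRate * suc e) Measured
    measurePath-correct = reaches-map finish
      (reaches-while measuring measureStep _ unmeasured Measuring measureStep-correct
        measureInit _ 1 (suc e) (s≤s (ℕₚ.m≤m+n e 0)) (measuring′ refl refl refl (λ ())))
      where
      finish : ∀ {τ} → Measuring τ × ¬ Truth measuring τ → Measured τ
      finish (measuring′ last≡ out≡ bound≡ x-suc , done) =
        measured last≡ out≡ bound≡ λ m<e → x-suc (ℕₚ.<-≤-trans m<e
          (subst (_≤ _) last≡ (ℕₚ.≮⇒≥ λ k<last → done (Level.lift k<last))))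

  -- The scan, over a real memory `R` that no longer changes.

  module _ (R : ℕ → ℕ → Carrier)
           (x-suc : ∀ {m} → m < e → R 1 (suc m) ≡ R 1 m +ᵣ distanceOracle P m (suc m)) where
    open Search F P (R 0 0) (R 1) x-suc

    cornersOf : Store → Corners
    cornersOf σ = corners (nats σ 1 3) (nats σ 1 4) (nats σ 1 5) (nats σ 1 6) (nats σ 1 7)

    record Scanning (σ : Store) : Set (c Level.⊔ ℓ₁ Level.⊔ ℓ₂) where
      constructor scanning′
      field
        last≡    : nats σ 1 0 ≡ e
        out≡     : nats σ 0 0 ≡ 0
        reals≡   : reals σ ≡ R
        extremes : Extremal (cornersOf σ) (nats σ 1 1)
        pending  : Unreached (nats σ 1 1) (nats σ 1 2)

    unscanned : Store → ℕ
    unscanned σ = (suc e ∸ nats σ 1 1) + (suc e ∸ nats σ 1 2)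

    Progress : ℕ → Store → Set (c Level.⊔ ℓ₁ Level.⊔ ℓ₂)
    Progress μ τ = Scanning τ × unscanned τ < μ

    -- The state after `recordSum`: the sum already accounts for k, the other two extremes do not.
    -- Both branches of `recordSum` continue from here.
    recordGap-correct : ∀ {N} → let k′ = N 1 1 ; l′ = N 1 2 in
      N 1 0 ≡ e → N 0 0 ≡ 0 → k′ ≤ e → l′ ≤ e → IsFar k′ l′ → Unreached k′ l′ →
      MinSum (suc k′) (N 1 3) (N 1 4) → MinGap k′ (N 1 5) (N 1 6) → MaxSum k′ (N 1 7) →
      Progress (unscanned (store N R)) (exec (recordGap ⨾ advance) (store N R))
    recordGap-correct {N} last≡ out≡ k≤e l≤e isFar pending s g m =
      exec-cond (λ τ → Progress _ (exec advance τ))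
        (position h₁ ⊕ position l ≤ℝ position k ⊕ position h₂) (5 ≔ k ⨾ 6 ≔ l) skip
        (λ smaller → scanning′ last≡ out≡ refl
           (extremal s (minGap-replace pending k≤e l≤e isFar smaller g) m′) pending′ , progress)
        (λ larger → scanning′ last≡ out≡ refl
           (extremal s (minGap-keep pending k≤e larger g) m′) pending′ , progress)
      where
      m′ = maxSum-replace pending k≤e l≤e isFar m
      pending′ = unreached-sucˡ pending
      progress = ℕₚ.+-monoˡ-< (suc e ∸ N 1 2) (ℕₚ.∸-monoʳ-< (ℕₚ.n<1+n (N 1 1)) (s≤s k≤e))

    scanStep-correct : ∀ {σ} → Scanning σ → Truth scanning σ →
                       Progress (unscanned σ) (exec scanStep σ)
    scanStep-correct {store N .R} (scanning′ last≡ out≡ refl (extremal s g m) pending)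
                     (Level.lift k≤last , Level.lift l≤last) =
      exec-cond (Progress (unscanned (store N R))) (position l ≤ℝ bound ⊕ position k)
        (2 ≔ lit 1 ⊞ l) (recordSum ⨾ recordGap ⨾ advance)
        (λ near → scanning′ last≡ out≡ refl (extremal s g m) (unreached-sucʳ near pending) ,
                  ℕₚ.+-monoʳ-< (suc e ∸ N 1 1) (ℕₚ.∸-monoʳ-< (ℕₚ.n<1+n _) (s≤s l≤e)))
        λ isFar → exec-cond (λ τ → Progress _ (exec (recordGap ⨾ advance) τ))
          (position k ⊕ position l ≤ℝ position a₁ ⊕ position a₂) (3 ≔ k ⨾ 4 ≔ l) skip
          (λ smaller → recordGap-correct last≡ out≡ k≤e l≤e isFar pending
                         (minSum-replace pending k≤e l≤e isFar smaller s) g m)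
          (λ larger  → recordGap-correct last≡ out≡ k≤e l≤e isFar pending
                         (minSum-keep pending k≤e larger s) g m)
      where
      k≤e = subst (N 1 1 ≤_) last≡ k≤last
      l≤e = subst (N 1 2 ≤_) last≡ l≤last

    Covered : ℕ → Set ℓ₂
    Covered n = ∀ {k′ l′} → k′ ≤ e → l′ ≤ e → IsFar k′ l′ → k′ < n

    record Scanned (σ : Store) : Set (c Level.⊔ ℓ₁ Level.⊔ ℓ₂) where
      constructor scanned
      field
        last≡    : nats σ 1 0 ≡ e
        reals≡   : reals σ ≡ R
        extremes : Extremal (cornersOf σ) (nats σ 1 1)
        covered  : Covered (nats σ 1 1)

    extremal-start : ∀ {m} → m ≡ e → IsFar 0 e → Extremal (corners 0 m 0 m 0) 0
    extremal-start refl 0-far = extremal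
      (minSum z≤n ℕₚ.≤-refl 0-far (λ ()))
      (minGap z≤n ℕₚ.≤-refl 0-far (λ ()))
      (maxSum z≤n 0-far (λ ()))

    scanFarPairs-correct : ∀ {N} → N 1 0 ≡ e → N 0 0 ≡ 0 → IsFar 0 e →
                           Reaches scanFarPairs (store N R) (scanRate * suc e)
                                   (λ τ → Scanned τ × nats τ 0 0 ≡ 0)
    scanFarPairs-correct last≡ out≡ 0-far = reaches-map finish
      (reaches-while scanning scanStep _ unscanned Scanning scanStep-correct
        scanInit _ 3 (suc e) (ℕₚ.+-mono-≤ (s≤s z≤n)
          (ℕₚ.+-monoʳ-≤ (suc e) (ℕₚ.m≤m+n (suc e) 0)))
        (scanning′ last≡ out≡ refl (extremal-start last≡ 0-far) (λ _ ())))
      where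
      finish : ∀ {τ} → Scanning τ × ¬ Truth scanning τ → Scanned τ × nats τ 0 0 ≡ 0
      finish {τ} (scanning′ last≡ out≡ reals≡ extremes pending , done) =
        scanned last≡ reals≡ extremes (unreached⇒< pending exceeded) , out≡
        where
        exceeded : e < nats τ 1 1 ⊎ e < nats τ 1 2
        exceeded with nats τ 1 1 ℕₚ.≤? e | nats τ 1 2 ℕₚ.≤? e
        ... | no k≰e  | _       = inj₁ (ℕₚ.≰⇒> k≰e)
        ... | yes _   | no l≰e  = inj₂ (ℕₚ.≰⇒> l≰e)
        ... | yes k≤e | yes l≤e = contradiction
          (Level.lift (subst (_ ≤_) (sym last≡) k≤e) ,
           Level.lift (subst (_ ≤_) (sym last≡) l≤e)) done

    -- The search loop.

    data Status (σ : Store) : Set (c Level.⊔ ℓ₁ Level.⊔ ℓ₂) where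
      open-ended : nats σ 0 0 ≡ 0 →
                   Swept (cornersOf σ) (nats σ 1 8) (nats σ 1 9) (nats σ 1 10) → Status σ
      answered   : nats σ 0 0 ≡ 1 → nats σ 0 1 ≤ e → nats σ 0 2 ≤ e →
                   FitsCorners (cornersOf σ) (nats σ 0 1) (nats σ 0 2) → e < nats σ 1 8 → Status σ

    Searching : Store → Set (c Level.⊔ ℓ₁ Level.⊔ ℓ₂)
    Searching σ = Scanned σ × Status σ

    unsearched : Store → ℕ
    unsearched σ = (suc e ∸ nats σ 1 8) + (nats σ 1 9 + (suc e ∸ nats σ 1 10))

    searchStep-correct : ∀ {σ} → Searching σ → Truth searching σ →
                         Searching (exec searchStep σ) ×
                         unsearched (exec searchStep σ) < unsearched σ
    searchStep-correct {store N .R}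
      (scanned last≡ refl extremes covered , answered _ _ _ _ e<i) (Level.lift i≤last) =
      -- An answer leaves `i` beyond `e`, so the loop test cannot have succeeded.
      contradiction (subst (N 1 8 ≤_) last≡ i≤last) (ℕₚ.<⇒≱ e<i)
    searchStep-correct {store N .R}
      (scanned last≡ refl extremes covered , open-ended out≡ sweep) (Level.lift i≤last) =
      exec-cond Goal lowerable (9 ≔ p ⊟ lit 1) tryRaise {σ}
        (λ (Level.lift 1≤p , fits′) →
          (scanned last≡ refl extremes covered ,
           open-ended out≡ (swept-lower-p κ 1≤p (to-e I (N 1 9 ∸ 1) fits′) sweep)) ,
          ℕₚ.+-monoʳ-< (suc e ∸ I) (ℕₚ.+-monoˡ-< (suc e ∸ Q) (ℕₚ.∸-monoʳ-< (s≤s z≤n) 1≤p)))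
        λ ¬lower → exec-cond Goal raisable (10 ≔ lit 1 ⊞ q) tryAnswer {σ}
          (λ (Level.lift q≤last , ¬fits) →
            (scanned last≡ refl extremes covered ,
             open-ended out≡ (swept-raise-q κ (≤-e q≤last)
               (λ fits′ → ¬fits (from-e I Q fits′)) sweep)) ,
            ℕₚ.+-monoʳ-< (suc e ∸ I) (ℕₚ.+-monoʳ-< (N 1 9)
              (ℕₚ.∸-monoʳ-< (ℕₚ.n<1+n Q) (s≤s (≤-e q≤last)))))
          λ ¬raise →
            -- Both failed tests together say that p and q have settled for this i; decidability of
            -- the order removes the double negation for q.
            let p-done = λ 1≤p fits′ → ¬lower (Level.lift 1≤p , from-e I (N 1 9 ∸ 1) fits′)
                q-done = λ q≤e → decidable-stable (_ ≤? _) λ ¬fits →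
                  ¬raise (Level.lift (subst (Q ≤_) (sym last≡) q≤e) ,
                          λ fits′ → ¬fits (to-e I Q fits′))
            in exec-cond Goal found (answer i p⊔q ⨾ 8 ≔ lit 1 ⊞ last) (8 ≔ lit 1 ⊞ i) {σ}
              (λ (Level.lift r≤last , below , narrow) →
                (scanned last≡ refl extremes covered , answered refl i≤e (≤-e r≤last)
                  (fits-found κ i≤e sweep p-done q-done (≤-e r≤last) below narrow)
                  (s≤s (ℕₚ.≤-reflexive (sym last≡)))) ,
                smaller (s≤s i≤last) (s≤s (ℕₚ.≤-reflexive last≡)))
              λ ¬found → (scanned last≡ refl extremes covered ,
                open-ended out≡ (swept-suc κ i≤e sweep p-done q-done λ r≤e below narrow →
                  ¬found (Level.lift (subst (_ ≤_) (sym last≡) r≤e) , below , narrow))) ,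
                smaller (ℕₚ.n<1+n I) (s≤s i≤e)
      where
      σ = store N R
      κ = cornersOf σ
      I = N 1 8
      Q = N 1 10
      Goal : Store → Set _
      Goal τ = Searching τ × unsearched τ < unsearched σ
      ≤-e : ∀ {m} → m ≤ N 1 0 → m ≤ e
      ≤-e = subst (_ ≤_) last≡
      i≤e = ≤-e i≤last
      to-e : ∀ u v {a a′ b′} → Fits u v a (N 1 0) a′ b′ → Fits u v a e a′ b′
      to-e u v {a} {a′} {b′} = subst (λ m → Fits u v a m a′ b′) last≡
      from-e : ∀ u v {a a′ b′} → Fits u v a e a′ b′ → Fits u v a (N 1 0) a′ b′
      from-e u v {a} {a′} {b′} = subst (λ m → Fits u v a m a′ b′) (sym last≡)
      smaller : ∀ {i′} → I < i′ → i′ ≤ suc e →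
        (suc e ∸ i′) + (N 1 9 + (suc e ∸ Q)) < (suc e ∸ I) + (N 1 9 + (suc e ∸ Q))
      smaller i<i′ i′≤1+e = ℕₚ.+-monoˡ-< _ (ℕₚ.∸-monoʳ-< i<i′ i′≤1+e)

    searchShortcut-correct : ∀ {σ} → Scanned σ → nats σ 0 0 ≡ 0 → IsFar 0 e →
                             Reaches searchShortcut σ (searchRate * suc e) (Correct (R 0 0))
    searchShortcut-correct {σ} (scanned last≡ reals≡ extremes covered) out≡ 0-far =
      reaches-map finish
      (reaches-while searching searchStep _ unsearched Searching searchStep-correct
        searchInit _ 4 (suc e)
        (ℕₚ.+-mono-≤ (s≤s z≤n) (ℕₚ.+-monoʳ-≤ (suc e)
          (ℕₚ.+-mono-≤ (ℕₚ.≤-reflexive (cong suc last≡)) (ℕₚ.m≤m+n (suc e) 0))))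
        (scanned last≡ reals≡ extremes covered ,
         open-ended out≡ (subst (λ m → Swept (cornersOf σ) 0 (suc m) 0) (sym last≡)
                                (swept-start (cornersOf σ)))))
      where
      finish : ∀ {τ} → Searching τ × ¬ Truth searching τ → Correct (R 0 0) τ
      finish ((scanned _ refl extremes covered , answered out≡ u≤e v≤e fits′ _) , _) =
        inj₁ (out≡ , fitsCorners⇒feasible extremes covered 0-far u≤e v≤e fits′)
      finish {τ} ((scanned last≡ refl extremes _ , open-ended out≡ sweep) , done) =
        -- Every first end has been swept, so a feasible edge, which fits the corners, is excluded
        -- by `none`.
        inj₂ (out≡ , λ (u , v , feasible) → Swept.none sweep
          (ℕₚ.≤-<-trans (ℕₚ.≤-pred (Finₚ.toℕ<n u)) e<i)
          (ℕₚ.≤-pred (Finₚ.toℕ<n u)) (ℕₚ.≤-pred (Finₚ.toℕ<n v))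
          (feasible⇒fitsCorners extremes 0-far feasible))
        where
        e<i : e < nats τ 1 8
        e<i = ℕₚ.≰⇒> λ i≤e → done (Level.lift (subst (_ ≤_) (sym last≡) i≤e))

    decide-correct : ∀ {N} → N 1 0 ≡ e → N 0 0 ≡ 0 →
      Reaches (cond far (scanFarPairs ⨾ searchShortcut) (answer (lit 0) (lit 0))) (store N R)
              (suc (testCost far + ((scanRate * suc e + searchRate * suc e) + answerTime)))
              (Correct (R 0 0))
    decide-correct {N} last≡ out≡ = reaches-cond far
      (λ isFar → let 0-far = subst (IsFar 0) last≡ isFar in
        reaches-mono (ℕₚ.m≤m+n (scanRate * suc e + searchRate * suc e) answerTime)
          (reaches-seq (scanFarPairs-correct last≡ out≡ 0-far)
            λ (scan , out≡′) → searchShortcut-correct scan out≡′ 0-far))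
      λ ¬far → reaches-mono (ℕₚ.m≤n+m answerTime (scanRate * suc e + searchRate * suc e))
        (reaches-exec (answer (lit 0) (lit 0)) _ {store N R}
          (inj₁ (refl , Fin.zero , Fin.zero ,
            near⇒feasible (decidable-stable (_ ≤? _)
              (λ 0-far → ¬far (subst (IsFar 0) (sym last≡) 0-far))) , refl , refl)))

  findShortcut-correct : ∀ λ₀ →
    Reaches findShortcut (input (suc e) λ₀) (findRate * suc e) (Correct λ₀)
  findShortcut-correct λ₀ = reaches-mono time
    (reaches-seq (measurePath-correct λ₀)
      λ { {store N R} (measured last≡ out≡ refl x-suc) → decide-correct R x-suc last≡ out≡ })
    where
    open ℕₚ.≤-Reasoning
    open +-*-Solver using (solve; _:*_; _:+_; _:=_)
    n = suc e
    time : measureRate * n + suc (testCost far + ((scanRate * n + searchRate * n) + answerTime))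
           ≤ findRate * n
    time = begin
      measureRate * n + (suc (testCost far) + ((scanRate * n + searchRate * n) + answerTime))
        ≤⟨ ℕₚ.+-monoʳ-≤ (measureRate * n) (ℕₚ.+-mono-≤ (ℕₚ.m≤m*n (suc (testCost far)) n)
             (ℕₚ.+-monoʳ-≤ (scanRate * n + searchRate * n) (ℕₚ.m≤m*n answerTime n))) ⟩
      measureRate * n +
        (suc (testCost far) * n + ((scanRate * n + searchRate * n) + answerTime * n))
        ≡⟨ solve 6 (λ a b c d f n → a :* n :+ (b :* n :+ ((c :* n :+ d :* n) :+ f :* n)) :=
                     (a :+ (b :+ (c :+ d :+ f))) :* n) refl
             measureRate (suc (testCost far)) scanRate searchRate answerTime n ⟩
      findRate * n ∎

theorem13 : ∀ {c ℓ₁ ℓ₂} (ℝ : RealNumbers c ℓ₁ ℓ₂) →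
    let open RealNumbers ℝ
        open OverField orderedField
    in
    ∃[ program ] ∃[ C ]
      (∀ (n : ℕ) .{{_ : NonZero n}} (P : MetricPath n) (bound : Carrier) →
        ∃[ t ] ∃[ σ ]
          (Runs P program (input n bound) t σ ×
           t ≤ C * n ×
           ((output σ 0 ≡ 1 ×
             (∃[ i ] ∃[ j ] (FeasibleEdge P bound i j ×
                             output σ 1 ≡ toℕ i ×
                             output σ 2 ≡ toℕ j)))
            ⊎
            (output σ 0 ≡ 0 × ¬ Feasible P bound))))
theorem13 ℝ = findShortcut , findRate , correct
  where
  open RealNumbers ℝ
  open OverField orderedField
  correct : ∀ n .{{_ : NonZero n}} (P : MetricPath n) λ₀ → _
  correct (suc e) P λ₀ = Correctness.findShortcut-correct orderedField P λ₀
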